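{- Let $n$ be a positive integer and let $$\psi(x)=\sum_{\pi\in\mathfrak{B}_n}\binom{x+n-\operatorname{ades}(\pi)}{n}\,\pi,$$ a polynomial in $x$ with coefficients in the group algebra $\mathbb{Q}[\mathfrak{B}_n]$ of the hyperoctahedral group. Then, as polynomials in $x$ and $y$ with coefficients in $\mathbb{Q}[\mathfrak{B}_n]$, $$\psi(x)\psi(y)=\psi(2xy),$$ or, upon substituting $x\leftarrow x/2$ and $y\leftarrow y/2$, $$\psi(x/2)\psi(y/2)=\psi(xy/2).$$
   Context: $\mathfrak{B}_n$ is the hyperoctahedral group: the group, under composition $(\sigma\tau)(s)=\sigma(\tau(s))$, of all bijections $\pi$ of $\{ -n,\ldots,-1,0,1,\ldots,n\}$ with $\pi(-s)=-\pi(s)$ for $s=0,1,\ldots,n$ (so $\pi(0)=0$). An element $\pi\in\mathfrak{B}_n$ has an augmented descent at position $i\in\{0,1,\ldots,n\}$ if $0\le i\le n-1$ and $\pi(i)>\pi(i+1)$, or if $i=n$ and $\pi(n)>0$. The augmented descent number $\operatorname{ades}(\pi)$ is the number of augmented descents of $\pi$. For a polynomial $p$, $\binom{p}{n}=\frac{p(p-1)\cdots(p-n+1)}{n!}$. The variables $x,y$ are commuting indeterminates that also commute with the elements of the group algebra. -}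

module Defs where

open import Algebra.Bundles using (Group)
open import Algebra.Bundles.Raw using (RawRing)
open import Data.Bool.Base using (if_then_else_)
open import Data.Fin.Base as Fin
  using (Fin; zero; suc; inject₁; fromℕ; opposite; _↑ʳ_)
import Data.Fin.Properties as Fin
open import Data.Fin.Permutation as Perm
  using (Permutation′; _⟨$⟩ʳ_; _⟨$⟩ˡ_; _∘ₚ_; flip; insert; remove)
open import Data.Integer.Base using (+_)
open import Data.List.Base as List
  using (List; []; _∷_; _++_; foldr; cartesianProductWith; allFin; filter; length)
open import Data.List.Membership.Propositional.Properties using (∈-allFin)
import Data.List.Membership.Setoid as Mem
import Data.List.Membership.Setoid.Properties as MemP
import Data.List.Relation.Unary.AllPairs as AllPairs
open import Data.List.Relation.Unary.All as All using (All)
open import Data.List.Relation.Unary.Any using (here; there)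
open import Data.List.Relation.Unary.Enumerates.Setoid using (IsEnumeration)
open import Data.List.Relation.Unary.Unique.Setoid using (Unique)
import Data.List.Relation.Unary.Unique.Setoid.Properties as Uniq
import Data.List.Relation.Unary.Unique.Propositional.Properties as UniqP
open import Data.Nat.Base as ℕ using (ℕ; zero; suc; _!)
import Data.Nat.Properties as ℕ
open import Data.Product.Base using (_×_; _,_)
open import Data.Rational.Base as ℚ using (ℚ)
open import Function.Base using (_∘_)
open import Level using (Level; 0ℓ; _⊔_)
open import Relation.Binary.Bundles using (Setoid)
import Relation.Binary.Construct.On as On
open import Relation.Binary.Definitions using (Decidable)
open import Relation.Binary.PropositionalEquality
open import Relation.Nullary using (Dec; yes; no; does; contradiction)

private
  variable
    c ℓ : Level

------------------------------------------------------------------------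
-- Univariate polynomials.  The indeterminate commutes with the coefficients,
-- which themselves need not commute.

module Polynomial (R : RawRing c ℓ) where

  private module R = RawRing R

  -- a₀ ∷ a₁ ∷ … represents a₀ + a₁ x + …; trailing zeros are allowed, so
  -- equality compares coefficients.
  Poly : Set c
  Poly = List R.Carrier

  coeff : Poly → ℕ → R.Carrier
  coeff []      _       = R.0#
  coeff (a ∷ p) zero    = a
  coeff (a ∷ p) (suc k) = coeff p k

  infix  4 _≈ₚ_
  infixl 6 _+ₚ_
  infixl 7 _*ₚ_

  _≈ₚ_ : Poly → Poly → Set ℓ
  p ≈ₚ q = ∀ k → coeff p k R.≈ coeff q k

  _+ₚ_ : Poly → Poly → Poly
  []      +ₚ q       = q
  (a ∷ p) +ₚ []      = a ∷ p
  (a ∷ p) +ₚ (b ∷ q) = a R.+ b ∷ p +ₚ q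

  _*ₚ_ : Poly → Poly → Poly
  []      *ₚ q = []
  (a ∷ p) *ₚ q = List.map (a R.*_) q +ₚ (R.0# ∷ p *ₚ q)

  const : R.Carrier → Poly
  const a = a ∷ []

  var : Poly
  var = R.0# ∷ R.1# ∷ []

  rawRing : RawRing c ℓ
  rawRing = record
    { Carrier = Poly
    ; _≈_     = _≈ₚ_
    ; _+_     = _+ₚ_
    ; _*_     = _*ₚ_
    ; -_      = List.map (R.-_)
    ; 0#      = []
    ; 1#      = const R.1#
    }

------------------------------------------------------------------------
-- The group algebra K[G]

module GroupAlgebra {g ℓ′} (K : RawRing c ℓ) (G : Group g ℓ′)
                    (_≟_ : Decidable (Group._≈_ G)) where

  private
    module K = RawRing K
    module G = Group G

  -- A list of pairs (a , g) is the formal sum of the a g.  A group element may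
  -- occur repeatedly, so equality compares the total coefficient at each one.
  FormalSum : Set (c ⊔ g)
  FormalSum = List (K.Carrier × G.Carrier)

  coeffAt : G.Carrier → FormalSum → K.Carrier
  coeffAt h []            = K.0#
  coeffAt h ((a , g) ∷ u) =
    if does (g ≟ h) then a K.+ coeffAt h u else coeffAt h u

  single : K.Carrier → G.Carrier → FormalSum
  single a g = (a , g) ∷ []

  rawRing : RawRing (c ⊔ g) (g ⊔ ℓ)
  rawRing = record
    { Carrier = FormalSum
    ; _≈_     = λ u v → ∀ h → coeffAt h u K.≈ coeffAt h v
    ; _+_     = _++_
    ; _*_     = cartesianProductWith λ (a , g) (b , h) → a K.* b , g G.∙ h
    ; -_      = List.map λ (a , g) → K.- a , g
    ; 0#      = []
    ; 1#      = single K.1# G.ε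
    }

------------------------------------------------------------------------
-- The hyperoctahedral group

-- The integer s with -n ≤ s ≤ n is encoded as the element n + s of
-- Fin (n + suc n).  This preserves the order, s ↦ -s becomes `opposite`, and
-- i in {0, …, n}, as an element of Fin (suc n), becomes n ↑ʳ i.
Signed : ℕ → Set
Signed n = Fin (n ℕ.+ suc n)

IsOdd : ∀ n → Permutation′ (n ℕ.+ suc n) → Set
IsOdd n π = ∀ s → π ⟨$⟩ʳ opposite s ≡ opposite (π ⟨$⟩ʳ s)

isOdd? : ∀ n (π : Permutation′ (n ℕ.+ suc n)) → Dec (IsOdd n π)
isOdd? n π = Fin.all? λ s → (π ⟨$⟩ʳ opposite s) Fin.≟ opposite (π ⟨$⟩ʳ s)

record SignedPerm (n : ℕ) : Set where
  constructor signed
  field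
    perm  : Permutation′ (n ℕ.+ suc n)
    isOdd : IsOdd n perm

open SignedPerm using (perm)

permSetoid : ℕ → Setoid 0ℓ 0ℓ
permSetoid m = On.setoid {B = Permutation′ m} (Fin m →-setoid Fin m) _⟨$⟩ʳ_

signedPermSetoid : ℕ → Setoid 0ℓ 0ℓ
signedPermSetoid n = On.setoid {B = SignedPerm n} (permSetoid (n ℕ.+ suc n)) perm

𝔅 : ℕ → Group 0ℓ 0ℓ
𝔅 n = record
  { Carrier = SignedPerm n
  ; _≈_     = Setoid._≈_ (signedPermSetoid n)
  -- `_∘ₚ_` is composition in diagrammatic order, whence the swap.
  ; _∙_     = λ (signed σ σ-odd) (signed τ τ-odd) →
                signed (τ ∘ₚ σ) λ s → trans (cong (σ ⟨$⟩ʳ_) (τ-odd s)) (σ-odd (τ ⟨$⟩ʳ s))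
  ; ε       = signed Perm.id λ _ → refl
  ; _⁻¹     = λ (signed σ σ-odd) → signed (flip σ) λ s → begin
      σ ⟨$⟩ˡ opposite s
        ≡⟨ cong (λ t → σ ⟨$⟩ˡ opposite t) (Perm.inverseʳ σ) ⟨
      σ ⟨$⟩ˡ opposite (σ ⟨$⟩ʳ (σ ⟨$⟩ˡ s))
        ≡⟨ cong (σ ⟨$⟩ˡ_) (σ-odd (σ ⟨$⟩ˡ s)) ⟨
      σ ⟨$⟩ˡ (σ ⟨$⟩ʳ opposite (σ ⟨$⟩ˡ s))
        ≡⟨ Perm.inverseˡ σ ⟩
      opposite (σ ⟨$⟩ˡ s) ∎
  ; isGroup = record
    { isMonoid = record
      { isSemigroup = record
        { isMagma = record
          { isEquivalence = Setoid.isEquivalence (signedPermSetoid n)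
          ; ∙-cong = λ { {signed σ _} {signed σ′ _} {signed τ _} {signed τ′ _} σ≈σ′ τ≈τ′ s →
              trans (cong (σ ⟨$⟩ʳ_) (τ≈τ′ s)) (σ≈σ′ (τ′ ⟨$⟩ʳ s)) }
          }
        ; assoc = λ _ _ _ _ → refl
        }
      ; identity = (λ _ _ → refl) , (λ _ _ → refl)
      }
    ; inverse = (λ (signed σ _) _ → Perm.inverseˡ σ) , (λ (signed σ _) _ → Perm.inverseʳ σ)
    ; ⁻¹-cong = λ { {signed σ _} {signed τ _} σ≈τ s → begin
        σ ⟨$⟩ˡ s                     ≡⟨ cong (σ ⟨$⟩ˡ_) (Perm.inverseʳ τ) ⟨
        σ ⟨$⟩ˡ (τ ⟨$⟩ʳ (τ ⟨$⟩ˡ s))   ≡⟨ cong (σ ⟨$⟩ˡ_) (σ≈τ (τ ⟨$⟩ˡ s)) ⟨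
        σ ⟨$⟩ˡ (σ ⟨$⟩ʳ (τ ⟨$⟩ˡ s))   ≡⟨ Perm.inverseˡ σ ⟩
        τ ⟨$⟩ˡ s                     ∎ }
    }
  }
  where open ≡-Reasoning

_≟𝔅_ : ∀ {n} → Decidable (Group._≈_ (𝔅 n))
signed σ _ ≟𝔅 signed τ _ = Fin.all? λ s → (σ ⟨$⟩ʳ s) Fin.≟ (τ ⟨$⟩ʳ s)

permutations : ∀ m → List (Permutation′ m)
permutations zero    = Perm.id ∷ []
permutations (suc m) = cartesianProductWith (insert zero) (allFin (suc m)) (permutations m)

selectOdd : ∀ {n} → List (Permutation′ (n ℕ.+ suc n)) → List (SignedPerm n)
selectOdd     []       = []
selectOdd {n} (π ∷ πs) with isOdd? n π
... | yes odd = signed π odd ∷ selectOdd πs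
... | no  _   = selectOdd πs

signedPerms : ∀ n → List (SignedPerm n)
signedPerms n = selectOdd (permutations (n ℕ.+ suc n))

-- Every element of 𝔅 n occurs exactly once in signedPerms n, so that summing
-- over this list is summing over the group.

private
  insert-cong : ∀ {m} j {σ τ : Permutation′ m} → σ Perm.≈ τ →
                insert zero j σ Perm.≈ insert zero j τ
  insert-cong j σ≈τ zero    = refl
  insert-cong j σ≈τ (suc s) = cong (Fin.punchIn j) (σ≈τ s)

  insert-injective : ∀ {m} {i j} {σ τ : Permutation′ m} →
                     insert zero i σ Perm.≈ insert zero j τ → i ≡ j × σ Perm.≈ τ
  insert-injective {i = i} {σ = σ} {τ} eq with eq zero
  ... | refl = refl , λ s → Fin.punchIn-injective i (σ ⟨$⟩ʳ s) (τ ⟨$⟩ʳ s) (eq (suc s))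

  permutations-enumerates : ∀ m → IsEnumeration (permSetoid m) (permutations m)
  permutations-enumerates zero    π = here λ ()
  permutations-enumerates (suc m) π =
    MemP.∈-resp-≈ (permSetoid (suc m)) {permutations (suc m)}
      {insert zero (π ⟨$⟩ʳ zero) (remove zero π)} {π} (Perm.insert-remove zero π)
      (MemP.∈-cartesianProductWith⁺ (setoid _) (permSetoid m) (permSetoid (suc m))
        (λ { {i} {_} {σ} {τ} refl σ≈τ → insert-cong i {σ} {τ} σ≈τ })
        (∈-allFin (π ⟨$⟩ʳ zero)) (permutations-enumerates m (remove zero π)))

  permutations-unique : ∀ m → Unique (permSetoid m) (permutations m)
  permutations-unique zero    = All.[] AllPairs.∷ AllPairs.[]
  permutations-unique (suc m) =
    Uniq.cartesianProductWith⁺ (setoid _) (permSetoid m) (permSetoid (suc m))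
      (insert zero) (λ {_} {_} {σ} {τ} → insert-injective {σ = σ} {τ})
      (UniqP.allFin⁺ (suc m)) (permutations-unique m)

  selectOdd-∈ : ∀ {n} (π : SignedPerm n) πs →
    Mem._∈_ (permSetoid (n ℕ.+ suc n)) (perm π) πs →
    Mem._∈_ (signedPermSetoid n) π (selectOdd πs)
  selectOdd-∈ {n} (signed π odd) (σ ∷ πs) π∈ with isOdd? n σ | π∈
  ... | yes _ | here π≈σ  = here π≈σ
  ... | yes _ | there π∈′ = there (selectOdd-∈ (signed π odd) πs π∈′)
  ... | no ¬o | there π∈′ = selectOdd-∈ (signed π odd) πs π∈′
  ... | no ¬o | here π≈σ  = contradiction
    (λ s → trans (sym (π≈σ (opposite s))) (trans (odd s) (cong opposite (π≈σ s)))) ¬o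

  selectOdd-All : ∀ {n} {P : Permutation′ (n ℕ.+ suc n) → Set} {πs} →
                  All P πs → All (P ∘ perm) (selectOdd {n} πs)
  selectOdd-All     All.[] = All.[]
  selectOdd-All {n} (All._∷_ {π} p ps) with isOdd? n π
  ... | yes _ = p All.∷ selectOdd-All ps
  ... | no  _ = selectOdd-All ps

  selectOdd-unique : ∀ {n} {πs} → Unique (permSetoid (n ℕ.+ suc n)) πs →
                     Unique (signedPermSetoid n) (selectOdd πs)
  selectOdd-unique     AllPairs.[] = AllPairs.[]
  selectOdd-unique {n} (AllPairs._∷_ {π} p ps) with isOdd? n π
  ... | yes _ = selectOdd-All {n} p AllPairs.∷ selectOdd-unique ps
  ... | no  _ = selectOdd-unique ps

signedPerms-enumerates : ∀ n → IsEnumeration (signedPermSetoid n) (signedPerms n)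
signedPerms-enumerates n π =
  selectOdd-∈ π _ (permutations-enumerates (n ℕ.+ suc n) (perm π))

signedPerms-unique : ∀ n → Unique (signedPermSetoid n) (signedPerms n)
signedPerms-unique n = selectOdd-unique (permutations-unique (n ℕ.+ suc n))

------------------------------------------------------------------------
-- Augmented descents

module _ {n : ℕ} where

  origin : Signed n
  origin = n ↑ʳ zero

  valueAt : SignedPerm n → Fin (suc n) → Signed n
  valueAt π i = perm π ⟨$⟩ʳ (n ↑ʳ i)

  ades : SignedPerm n → ℕ
  ades π =
    length (filter (λ i → valueAt π (suc i) Fin.<? valueAt π (inject₁ i)) (allFin n))
    ℕ.+ (if does (origin Fin.<? valueAt π (fromℕ n)) then 1 else 0)

------------------------------------------------------------------------
-- Binomial coefficients of polynomials over ℚ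

module ℚ[x] where
  open Polynomial ℚ.+-*-rawRing public
  open RawRing rawRing public using (_+_; _*_; -_; 1#)

  fromℕℚ : ℕ → ℚ
  fromℕℚ k = + k ℚ./ 1

  falling : Poly → ℕ → Poly
  falling p zero    = 1#
  falling p (suc k) = falling p k * (p + - const (fromℕℚ k))

  binomial : Poly → ℕ → Poly
  binomial p k = const (ℚ._/_ (+ 1) (k !) {{k ℕ.!≢0}}) * falling p k

------------------------------------------------------------------------
-- ψ, as a polynomial in x over A = ℚ[𝔅 n], and its substitution instances in
-- A[x,y] = A[x][y]

module Psi (n : ℕ) where

  module A      = GroupAlgebra ℚ.+-*-rawRing (𝔅 n) _≟𝔅_
  module A[x]   = Polynomial A.rawRing
  module A[x,y] = Polynomial A[x].rawRing

  open RawRing A[x,y].rawRing public using (_≈_; _+_; _*_; 0#)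

  term : SignedPerm n → A[x].Poly
  term π = List.map (λ a → A.single a π)
    (ℚ[x].binomial
      (ℚ[x].var ℚ[x].+ ℚ[x].const (ℚ[x].fromℕℚ n)
                ℚ[x].+ ℚ[x].- ℚ[x].const (ℚ[x].fromℕℚ (ades π)))
      n)

  ψ : A[x].Poly
  ψ = foldr A[x]._+ₚ_ [] (List.map term (signedPerms n))

  constant : RawRing.Carrier A.rawRing → A[x,y].Poly
  constant a = A[x,y].const (A[x].const a)

  scalar : ℚ → A[x,y].Poly
  scalar q = constant (A.single q (Group.ε (𝔅 n)))

  x y : A[x,y].Poly
  x = A[x,y].const A[x].var
  y = A[x,y].var

  -- Horner evaluation; this is substitution for the indeterminate when s is
  -- central, as are all the polynomials in x and y with scalar coefficients.
  infix 8 _⟪_⟫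
  _⟪_⟫ : A[x].Poly → A[x,y].Poly → A[x,y].Poly
  p ⟪ s ⟫ = foldr (λ a r → constant a + s * r) 0# p

{-# OPTIONS --safe #-}
module Submission where

-- For large j in ℕ the coefficient of π in ψ(j) counts the sequences 0 = a₀ ≤ a₁ ≤ … ≤ aₙ ≤ j
-- with a strict inequality at each augmented descent of π. Extended to an odd function A on
-- {-n, …, n}, such a sequence is characterised by: the pairs (A s , π s) increase
-- lexicographically with s, and all of them lie below (j , 0).
--
-- If A is of this kind for σ and j, and B for τ and k, then s ↦ 2j B(s) + A(τ s) is of this
-- kind for στ and 2jk. Conversely each C for π and 2jk arises from exactly one (σ , A , B) with
-- τ = σ⁻¹π: the value A(τ s) is the residue of C(s) modulo 2j in [-j , j], where the sign of π s
-- decides between -j and j, and σ is the permutation sorting the pairs (residue , π s). Hence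
-- ψ(j)ψ(k) = ψ(2jk) for all large j and k, which determines both sides as polynomials.

open import Defs
open import Algebra.Bundles using (AbelianGroup; Group; Monoid)
open import Algebra.Bundles.Raw using (RawRing)
import Algebra.Construct.Terminal as Terminal
import Algebra.Properties.Group as GroupProperties
open import Data.Bool.Base using (Bool; true; false; if_then_else_)
open import Data.Fin.Base as Fin
  using (Fin; zero; suc; inject₁; fromℕ; opposite; punchIn; splitAt; _↑ˡ_; _↑ʳ_)
open import Data.Fin.Induction using (<-weakInduction)
open import Data.Fin.Permutation as Perm
  using (Permutation′; _⟨$⟩ʳ_; _⟨$⟩ˡ_; _∘ₚ_; insert; inverseˡ; inverseʳ)
import Data.Fin.Properties as Fin
open import Data.Integer.Base as ℤ using (ℤ)
import Data.Integer.DivMod as ℤ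
import Data.Integer.Properties as ℤ
open import Data.List.Base as List
  using (List; []; _∷_; _++_; foldr; length; map; filter; concat; cartesianProduct)
open import Data.List.Membership.Propositional.Properties
  using (∈-map⁺; ∈-map⁻; ∈-++⁺ˡ; ∈-++⁺ʳ; ∈-++⁻; ∈-lookup; ∈-cartesianProduct⁺; ∈-cartesianProduct⁻)
import Data.List.Membership.Setoid as Membership
import Data.List.Membership.Setoid.Properties as Membershipₚ
import Data.List.Properties as List
open import Data.List.Relation.Unary.All as All using (All; []; _∷_)
import Data.List.Relation.Unary.All.Properties as All
open import Data.List.Relation.Unary.AllPairs as AllPairs using ([]; _∷_)
import Data.List.Relation.Unary.AllPairs.Properties as AllPairs
open import Data.List.Relation.Unary.Any as Any using (here; there; index)
import Data.List.Relation.Unary.Any.Properties as Any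
import Data.List.Relation.Unary.Unique.Propositional.Properties as Uniqueₚ
open import Data.List.Relation.Unary.Unique.Setoid using (Unique)
import Data.List.Relation.Unary.Unique.Setoid.Properties as Unique
open import Data.Nat.Base as ℕ using (ℕ; zero; suc; z≤n; s≤s; NonZero; _!)
import Data.Nat.Properties as ℕ
open import Data.Product.Base using (_×_; _,_; proj₁; proj₂; ∃; ∃₂)
open import Data.Product.Relation.Binary.Lex.Strict using (×-strictTotalOrder)
open import Data.Product.Relation.Binary.Pointwise.NonDependent using (_×ₛ_)
open import Data.Rational.Base as ℚ using (ℚ; 0ℚ; 1ℚ; ½; _/_)
import Data.Rational.Properties as ℚ
import Data.Rational.Unnormalised.Base as ℚᵘ
import Data.Rational.Unnormalised.Properties as ℚᵘ
open import Data.Sum.Base using (inj₁; inj₂; [_,_]′)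
open import Data.Vec.Base as Vec using (Vec; []; _∷_)
import Data.Vec.Properties as Vec
open import Function.Base using (_∘_; id)
open import Function.Bundles using (mk⇔)
open import Level using (Level; 0ℓ; _⊔_)
open import Relation.Binary.Bundles using (Setoid; StrictTotalOrder)
open import Relation.Binary.Core using (Rel)
open import Relation.Binary.Definitions using (Decidable; Transitive; tri<; tri≈; tri>)
open import Relation.Binary.PropositionalEquality hiding (J)
open import Relation.Nullary using (Dec; yes; no; does; ¬_; contradiction)
open import Relation.Nullary.Decidable using (does-⇔)
open import Relation.Unary using (Pred)
import Relation.Unary as Unary

-- The factor 2 in ψ(2xy) is the length 2j of the interval [-j , j]: the values of C are cut into
-- translates of this interval by multiples of 2j, numbered by B. Neighbouring translates share an
-- endpoint, and the sign of the second component assigns a pair there to one of them; this is why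
-- pairs are compared. Likewise the bound (j , 0) compares π(n) with 0 and so accounts for the
-- augmented descent at n.
--
-- The polynomials are lists of lists of formal sums with coefficientwise equality, over a
-- noncommutative algebra, and no ring laws are established for them. Instead, a linear functional φ
-- on the group algebra, together with rational values for x and y, sends each polynomial to a
-- rational number and products to iterated sums; the indicator functionals recover all
-- coefficients. What remains is rational arithmetic and the fact that a rational polynomial with
-- infinitely many roots is zero, applied once for y and once for x. The points of evaluation are
-- even numbers, so that x/2 takes natural values too and one count yields both identities.

-- Evaluation of polynomials over a group algebra by linear functionals.

module Evaluations where
  open import Data.Rational.Base using (_+_; _*_; -_; _-_; 1/_; ≢-nonZero; toℚᵘ; +-*-rawRing)
  open import Data.Rational.Solver using (module +-*-Solver)
  open +-*-Solver using (solve; _:+_; _:*_; :-_; _:-_; con; _:=_)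
  open ℚ[x] using (fromℕℚ; falling; binomial)
  open ≡-Reasoning

  private
    variable
      a c g ℓ ℓ′ : Level
      X : Set a

  -- ⟦ Σ aᵤ u ⟧ φ = Σ aᵤ φ(u): these functionals determine an element of a group algebra, and
  -- turn products into iterated sums.
  record Interpretation (R : RawRing c ℓ) (M : Monoid g ℓ′) : Set (c ⊔ g ⊔ ℓ′) where
    private
      module R = RawRing R
      module M = Monoid M
    field
      ⟦_⟧       : R.Carrier → (M.Carrier → ℚ) → ℚ
      ⟦⟧-cong   : ∀ a {φ χ} → (∀ u → φ u ≡ χ u) → ⟦ a ⟧ φ ≡ ⟦ a ⟧ χ
      ⟦⟧-linear : ∀ a s φ χ → ⟦ a ⟧ (λ u → φ u + s * χ u) ≡ ⟦ a ⟧ φ + s * ⟦ a ⟧ χ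
      +-homo    : ∀ a b φ → ⟦ a R.+ b ⟧ φ ≡ ⟦ a ⟧ φ + ⟦ b ⟧ φ
      *-homo    : ∀ a b φ → ⟦ a R.* b ⟧ φ ≡ ⟦ a ⟧ (λ u → ⟦ b ⟧ (λ v → φ (u M.∙ v)))
      -‿homo    : ∀ a φ → ⟦ R.- a ⟧ φ ≡ - ⟦ a ⟧ φ
      0-homo    : ∀ φ → ⟦ R.0# ⟧ φ ≡ 0ℚ
      1-homo    : ∀ φ → ⟦ R.1# ⟧ φ ≡ φ M.ε

    -- Linearity with φ = χ = 0 and s = -1: the combined functional reduces to 0 again, so V = V -
    -- V.
    ⟦⟧-zero : ∀ a → ⟦ a ⟧ (λ _ → 0ℚ) ≡ 0ℚ
    ⟦⟧-zero a = begin
      V                  ≡⟨ ⟦⟧-linear a (- 1ℚ) _ _ ⟩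
      V + (- 1ℚ) * V     ≡⟨ solve 1 (λ x → x :+ (:- con 1ℚ) :* x := con 0ℚ) refl V ⟩
      0ℚ ∎
      where V = ⟦ a ⟧ (λ _ → 0ℚ)

    -- A record, so that the scalar is inferable.
    record IsScalar (a : R.Carrier) (s : ℚ) : Set (g ⊔ ℓ′) where
      constructor isScalar
      field apply : ∀ φ → (∀ {u v} → u M.≈ v → φ u ≡ φ v) → ⟦ a ⟧ φ ≡ s * φ M.ε
    open IsScalar public

    -- The first factor contributes its scalar and the unit, leaving φ (ε ∙ v). Its argument is only
    -- equivalent to v, whence the restriction to functionals that respect `M.≈`.
    scalar-* : ∀ {a b s t} → IsScalar a s → IsScalar b t → IsScalar (a R.* b) (s * t)
    scalar-* {a} {b} {s} {t} sa sb .apply φ φ-cong = begin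
      ⟦ a R.* b ⟧ φ                            ≡⟨ *-homo a b φ ⟩
      ⟦ a ⟧ (λ u → ⟦ b ⟧ (λ v → φ (u M.∙ v)))  ≡⟨ sa .apply _ (λ u≈v → ⟦⟧-cong b (λ w → φ-cong (M.∙-congʳ u≈v))) ⟩
      s * ⟦ b ⟧ (λ v → φ (M.ε M.∙ v))          ≡⟨ cong (s *_) (⟦⟧-cong b (λ v → φ-cong (M.identityˡ v))) ⟩
      s * ⟦ b ⟧ φ                              ≡⟨ cong (s *_) (sb .apply φ φ-cong) ⟩
      s * (t * φ M.ε)                          ≡⟨ ℚ.*-assoc s t _ ⟨
      s * t * φ M.ε                            ∎

    scalar-+ : ∀ {a b s t} → IsScalar a s → IsScalar b t → IsScalar (a R.+ b) (s + t)
    scalar-+ {a} {b} {s} {t} sa sb .apply φ φ-cong = begin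
      ⟦ a R.+ b ⟧ φ             ≡⟨ +-homo a b φ ⟩
      ⟦ a ⟧ φ + ⟦ b ⟧ φ         ≡⟨ cong₂ _+_ (sa .apply φ φ-cong) (sb .apply φ φ-cong) ⟩
      s * φ M.ε + t * φ M.ε     ≡⟨ ℚ.*-distribʳ-+ (φ M.ε) s t ⟨
      (s + t) * φ M.ε           ∎

    scalar-neg : ∀ {a s} → IsScalar a s → IsScalar (R.- a) (- s)
    scalar-neg {a} {s} sa .apply φ φ-cong = begin
      ⟦ R.- a ⟧ φ      ≡⟨ -‿homo a φ ⟩
      - ⟦ a ⟧ φ        ≡⟨ cong -_ (sa .apply φ φ-cong) ⟩
      - (s * φ M.ε)    ≡⟨ ℚ.neg-distribˡ-* s _ ⟩
      - s * φ M.ε      ∎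

    scalar-1 : IsScalar R.1# 1ℚ
    scalar-1 .apply φ _ = trans (1-homo φ) (sym (ℚ.*-identityˡ _))

  module Evaluation {R : RawRing c ℓ} {M : Monoid g ℓ′} (I : Interpretation R M) (p : ℚ) where
    private
      module R = RawRing R
      module M = Monoid M
      open Interpretation I
      module P = Polynomial R
      module PR = RawRing P.rawRing

    eval : P.Poly → (M.Carrier → ℚ) → ℚ
    eval f φ = foldr (λ a r → ⟦ a ⟧ φ + p * r) 0ℚ f

    private
      eval-cong : ∀ f {φ χ} → (∀ u → φ u ≡ χ u) → eval f φ ≡ eval f χ
      eval-cong []      eq = refl
      eval-cong (a ∷ f) eq = cong₂ (λ s t → s + p * t) (⟦⟧-cong a eq) (eval-cong f eq)

      eval-linear : ∀ f s φ χ → eval f (λ u → φ u + s * χ u) ≡ eval f φ + s * eval f χ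
      eval-linear []      s φ χ = solve 1 (λ s → con 0ℚ := con 0ℚ :+ s :* con 0ℚ) refl s
      eval-linear (a ∷ f) s φ χ = begin
        ⟦ a ⟧ (λ u → φ u + s * χ u) + p * eval f (λ u → φ u + s * χ u)
          ≡⟨ cong₂ (λ y z → y + p * z) (⟦⟧-linear a s φ χ) (eval-linear f s φ χ) ⟩
        (⟦ a ⟧ φ + s * ⟦ a ⟧ χ) + p * (eval f φ + s * eval f χ)
          ≡⟨ solve 6 (λ A B F G s p → (A :+ s :* B) :+ p :* (F :+ s :* G)
                                   := (A :+ p :* F) :+ s :* (B :+ p :* G)) refl
               (⟦ a ⟧ φ) (⟦ a ⟧ χ) (eval f φ) (eval f χ) s p ⟩
        (⟦ a ⟧ φ + p * eval f φ) + s * (⟦ a ⟧ χ + p * eval f χ) ∎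

      eval-+ : ∀ f h φ → eval (f P.+ₚ h) φ ≡ eval f φ + eval h φ
      eval-+ []      h       φ = sym (ℚ.+-identityˡ _)
      eval-+ (a ∷ f) []      φ = sym (ℚ.+-identityʳ _)
      eval-+ (a ∷ f) (b ∷ h) φ = begin
        ⟦ a R.+ b ⟧ φ + p * eval (f P.+ₚ h) φ
          ≡⟨ cong₂ (λ y z → y + p * z) (+-homo a b φ) (eval-+ f h φ) ⟩
        (⟦ a ⟧ φ + ⟦ b ⟧ φ) + p * (eval f φ + eval h φ)
          ≡⟨ solve 5 (λ A B F G p → (A :+ B) :+ p :* (F :+ G) := (A :+ p :* F) :+ (B :+ p :* G))
               refl (⟦ a ⟧ φ) (⟦ b ⟧ φ) (eval f φ) (eval h φ) p ⟩
        (⟦ a ⟧ φ + p * eval f φ) + (⟦ b ⟧ φ + p * eval h φ) ∎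

      eval-neg : ∀ f φ → eval (List.map R.-_ f) φ ≡ - eval f φ
      eval-neg []      φ = refl
      eval-neg (a ∷ f) φ = begin
        ⟦ R.- a ⟧ φ + p * eval (List.map R.-_ f) φ
          ≡⟨ cong₂ (λ y z → y + p * z) (-‿homo a φ) (eval-neg f φ) ⟩
        - ⟦ a ⟧ φ + p * - eval f φ
          ≡⟨ solve 3 (λ A F p → (:- A) :+ p :* (:- F) := :- (A :+ p :* F)) refl (⟦ a ⟧ φ) (eval f φ) p ⟩
        - (⟦ a ⟧ φ + p * eval f φ) ∎

      eval-scale : ∀ a f φ →
        eval (List.map (a R.*_) f) φ ≡ ⟦ a ⟧ (λ u → eval f (λ v → φ (u M.∙ v)))
      eval-scale a []      φ = sym (⟦⟧-zero a)
      eval-scale a (b ∷ f) φ = begin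
        ⟦ a R.* b ⟧ φ + p * eval (List.map (a R.*_) f) φ
          ≡⟨ cong₂ (λ y z → y + p * z) (*-homo a b φ) (eval-scale a f φ) ⟩
        ⟦ a ⟧ (λ u → ⟦ b ⟧ (λ v → φ (u M.∙ v))) + p * ⟦ a ⟧ (λ u → eval f (λ v → φ (u M.∙ v)))
          ≡⟨ ⟦⟧-linear a p _ _ ⟨
        ⟦ a ⟧ (λ u → ⟦ b ⟧ (λ v → φ (u M.∙ v)) + p * eval f (λ v → φ (u M.∙ v))) ∎

      eval-* : ∀ f h φ → eval (f P.*ₚ h) φ ≡ eval f (λ u → eval h (λ v → φ (u M.∙ v)))
      eval-* []      h φ = refl
      eval-* (a ∷ f) h φ = begin
        eval (List.map (a R.*_) h P.+ₚ (R.0# ∷ f P.*ₚ h)) φ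
          ≡⟨ eval-+ (List.map (a R.*_) h) _ φ ⟩
        eval (List.map (a R.*_) h) φ + (⟦ R.0# ⟧ φ + p * eval (f P.*ₚ h) φ)
          ≡⟨ cong₂ _+_ (eval-scale a h φ)
               (trans (cong₂ (λ y z → y + p * z) (0-homo φ) (eval-* f h φ)) (ℚ.+-identityˡ _)) ⟩
        ⟦ a ⟧ (λ u → eval h (λ v → φ (u M.∙ v)))
          + p * eval f (λ u → eval h (λ v → φ (u M.∙ v))) ∎

      eval-const : ∀ a φ → eval (P.const a) φ ≡ ⟦ a ⟧ φ
      eval-const a φ = solve 2 (λ A p → A :+ p :* con 0ℚ := A) refl (⟦ a ⟧ φ) p

    -- Evaluation at `p` is again an interpretation, over the same monoid because the indeterminate
    -- commutes with its elements. Hence the construction iterates: once for x, once more for y.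
    interpretation : Interpretation P.rawRing M
    interpretation = record
      { ⟦_⟧       = eval
      ; ⟦⟧-cong   = eval-cong
      ; ⟦⟧-linear = eval-linear
      ; +-homo    = eval-+
      ; *-homo    = eval-*
      ; -‿homo    = eval-neg
      ; 0-homo    = λ _ → refl
      ; 1-homo    = λ φ → trans (eval-const R.1# φ) (1-homo φ)
      }

    private module J = Interpretation interpretation

    scalar-const : ∀ {a s} → IsScalar a s → J.IsScalar (P.const a) s
    scalar-const {a} sa .J.apply φ φ-cong = trans (eval-const a φ) (sa .apply φ φ-cong)

    scalar-var : J.IsScalar P.var p
    scalar-var .J.apply φ _ = begin
      ⟦ R.0# ⟧ φ + p * (⟦ R.1# ⟧ φ + p * 0ℚ)
        ≡⟨ cong₂ (λ y z → y + p * (z + p * 0ℚ)) (0-homo φ) (1-homo φ) ⟩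
      0ℚ + p * (φ M.ε + p * 0ℚ)
        ≡⟨ solve 2 (λ e p → con 0ℚ :+ p :* (e :+ p :* con 0ℚ) := p :* e) refl (φ M.ε) p ⟩
      p * φ M.ε ∎

  open GroupProperties ℚ.+-0-group using () renaming (x∙y⁻¹≈ε⇒x≈y to p-q≡0⇒p≡q)

  p≢0∧p*q≡0⇒q≡0 : ∀ {p q} → p ≢ 0ℚ → p * q ≡ 0ℚ → q ≡ 0ℚ
  p≢0∧p*q≡0⇒q≡0 {p} {q} p≢0 pq≡0 = begin
    q              ≡⟨ ℚ.*-identityˡ q ⟨
    1ℚ * q         ≡⟨ cong (_* q) (ℚ.*-inverseˡ p) ⟨
    1/ p * p * q   ≡⟨ ℚ.*-assoc (1/ p) p q ⟩
    1/ p * (p * q) ≡⟨ cong (1/ p *_) pq≡0 ⟩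
    1/ p * 0ℚ      ≡⟨ ℚ.*-zeroʳ (1/ p) ⟩
    0ℚ             ∎
    where instance _ = ≢-nonZero p≢0

  horner : List ℚ → ℚ → ℚ
  horner f s = foldr (λ a r → a + s * r) 0ℚ f

  -- The quotient of the synthetic division of a ∷ f by X - s is tailValues s f.
  tailValues : ℚ → List ℚ → List ℚ
  tailValues s []      = []
  tailValues s (a ∷ f) = horner (a ∷ f) s ∷ tailValues s f

  horner-divide : ∀ s a f t →
    horner (a ∷ f) t ≡ horner (a ∷ f) s + (t - s) * horner (tailValues s f) t
  horner-divide s a []      t =
    solve 3 (λ a s t → a :+ t :* con 0ℚ := (a :+ s :* con 0ℚ) :+ (t :- s) :* con 0ℚ) refl a s t
  horner-divide s a (b ∷ f) t = begin
    a + t * horner (b ∷ f) t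
      ≡⟨ cong (λ z → a + t * z) (horner-divide s b f t) ⟩
    a + t * (F + (t - s) * Q)
      ≡⟨ solve 5 (λ a t s F Q → a :+ t :* (F :+ (t :- s) :* Q)
                             := (a :+ s :* F) :+ (t :- s) :* (F :+ t :* Q)) refl a t s F Q ⟩
    (a + s * F) + (t - s) * (F + t * Q) ∎
    where F = horner (b ∷ f) s ; Q = horner (tailValues s f) t

  horner-zero : ∀ {f} s → All (_≡ 0ℚ) f → horner f s ≡ 0ℚ
  horner-zero s []              = refl
  horner-zero s (refl ∷ zeros) = trans (ℚ.+-identityˡ _)
    (trans (cong (s *_) (horner-zero s zeros)) (ℚ.*-zeroʳ s))

  a+s*0≡0⇒a≡0 : ∀ {a r} s → r ≡ 0ℚ → a + s * r ≡ 0ℚ → a ≡ 0ℚ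
  a+s*0≡0⇒a≡0 {a} s refl eq = trans (solve 2 (λ a s → a := a :+ s :* con 0ℚ) refl a s) eq

  -- The coefficients are recovered from the end: once the tail is known to vanish, the value of a ∷
  -- f at s is just a.
  tailValues-zero : ∀ s f → All (_≡ 0ℚ) (tailValues s f) → All (_≡ 0ℚ) f
  tailValues-zero s []      []             = []
  tailValues-zero s (a ∷ f) (eq ∷ zeros) = a+s*0≡0⇒a≡0 s (horner-zero s fs) eq ∷ fs
    where fs = tailValues-zero s f zeros

  length-tailValues : ∀ s f → length (tailValues s f) ≡ length f
  length-tailValues s []      = refl
  length-tailValues s (a ∷ f) = cong suc (length-tailValues s f)

  module _ {e : ℕ → ℚ} (e-injective : ∀ {i j} → e i ≡ e j → i ≡ j) where

    -- Dividing by the root `e m` leaves the quotient `tailValues (e m) f`, which vanishes at every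
    -- later point because `e i - e m` is nonzero and can be cancelled. The quotient is shorter but
    -- not a subterm, so the induction runs on the length `l`.
    roots⇒zero : ∀ l f → length f ≡ l → ∀ m → (∀ i → m ℕ.≤ i → horner f (e i) ≡ 0ℚ) →
                 All (_≡ 0ℚ) f
    roots⇒zero _       []      _  _ _     = []
    roots⇒zero (suc l) (a ∷ f) eq m roots =
      a+s*0≡0⇒a≡0 (e m) (horner-zero (e m) zeros) (roots m ℕ.≤-refl) ∷ zeros
      where
      quotient-roots : ∀ i → suc m ℕ.≤ i → horner (tailValues (e m) f) (e i) ≡ 0ℚ
      quotient-roots i m<i = p≢0∧p*q≡0⇒q≡0
        (λ e≡ → ℕ.<⇒≢ m<i (sym (e-injective (p-q≡0⇒p≡q _ _ e≡)))) (begin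
        (e i - e m) * Q                        ≡⟨ ℚ.+-identityˡ _ ⟨
        0ℚ + (e i - e m) * Q                   ≡⟨ cong (_+ (e i - e m) * Q) (roots m ℕ.≤-refl) ⟨
        horner (a ∷ f) (e m) + (e i - e m) * Q ≡⟨ horner-divide (e m) a f (e i) ⟨
        horner (a ∷ f) (e i)                   ≡⟨ roots i (ℕ.<⇒≤ m<i) ⟩
        0ℚ                                     ∎)
        where Q = horner (tailValues (e m) f) (e i)
      zeros = tailValues-zero (e m) f
        (roots⇒zero l _ (trans (length-tailValues (e m) f) (ℕ.suc-injective eq)) (suc m) quotient-roots)

    module _ {R : RawRing c ℓ} {M : Monoid g ℓ′} (I : Interpretation R M) where
      private
        module R = RawRing R
        module P = Polynomial R
        module PR = RawRing P.rawRing
        open Interpretation I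
        module Ev p = Interpretation (Evaluation.interpretation I p)
      open Evaluation I using (eval)

      eval≡horner : ∀ p f φ → eval p f φ ≡ horner (List.map (λ a → ⟦ a ⟧ φ) f) p
      eval≡horner p []      φ = refl
      eval≡horner p (a ∷ f) φ = cong (λ z → ⟦ a ⟧ φ + p * z) (eval≡horner p f φ)

      zero⇒coeff : ∀ {φ f} → All (_≡ 0ℚ) (List.map (λ a → ⟦ a ⟧ φ) f) → ∀ k → ⟦ P.coeff f k ⟧ φ ≡ 0ℚ
      zero⇒coeff {φ} {[]}    []           k       = 0-homo φ
      zero⇒coeff {φ} {a ∷ f} (eq ∷ zeros) zero    = eq
      zero⇒coeff {φ} {a ∷ f} (eq ∷ zeros) (suc k) = zero⇒coeff zeros k

      coeff-+ : ∀ f h k φ → ⟦ P.coeff (f P.+ₚ h) k ⟧ φ ≡ ⟦ P.coeff f k ⟧ φ + ⟦ P.coeff h k ⟧ φ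
      coeff-+ []      h       k       φ = sym (trans (cong (_+ ⟦ P.coeff h k ⟧ φ) (0-homo φ)) (ℚ.+-identityˡ _))
      coeff-+ (a ∷ f) []      k       φ = sym (trans (cong (⟦ P.coeff (a ∷ f) k ⟧ φ +_) (0-homo φ)) (ℚ.+-identityʳ _))
      coeff-+ (a ∷ f) (b ∷ h) zero    φ = +-homo a b φ
      coeff-+ (a ∷ f) (b ∷ h) (suc k) φ = coeff-+ f h k φ

      coeff-neg : ∀ f k φ → ⟦ P.coeff (PR.- f) k ⟧ φ ≡ - ⟦ P.coeff f k ⟧ φ
      coeff-neg []      k       φ = trans (0-homo φ) (cong -_ (sym (0-homo φ)))
      coeff-neg (a ∷ f) zero    φ = -‿homo a φ
      coeff-neg (a ∷ f) (suc k) φ = coeff-neg f k φ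

      -- Applying φ to each coefficient of f - h gives a rational polynomial, so the count of roots
      -- takes place over a field although `R` need not be commutative.
      polynomial-identity : ∀ f h φ m → (∀ i → m ℕ.≤ i → eval (e i) f φ ≡ eval (e i) h φ) →
                            ∀ k → ⟦ P.coeff f k ⟧ φ ≡ ⟦ P.coeff h k ⟧ φ
      polynomial-identity f h φ m eq k = p-q≡0⇒p≡q _ _ (begin
        ⟦ P.coeff f k ⟧ φ - ⟦ P.coeff h k ⟧ φ
          ≡⟨ cong (⟦ P.coeff f k ⟧ φ +_) (coeff-neg h k φ) ⟨
        ⟦ P.coeff f k ⟧ φ + ⟦ P.coeff (PR.- h) k ⟧ φ
          ≡⟨ coeff-+ f _ k φ ⟨
        ⟦ P.coeff d k ⟧ φ
          ≡⟨ zero⇒coeff {f = d} (roots⇒zero _ _ refl m roots) k ⟩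
        0ℚ ∎)
        where
        d = f P.+ₚ PR.- h
        roots : ∀ i → m ℕ.≤ i → horner (List.map (λ a → ⟦ a ⟧ φ) d) (e i) ≡ 0ℚ
        roots i m≤i = begin
          horner (List.map (λ a → ⟦ a ⟧ φ) d) (e i)    ≡⟨ eval≡horner (e i) d φ ⟨
          eval (e i) d φ                               ≡⟨ Ev.+-homo (e i) f (PR.- h) φ ⟩
          eval (e i) f φ + eval (e i) (PR.- h) φ       ≡⟨ cong (eval (e i) f φ +_) (Ev.-‿homo (e i) h φ) ⟩
          eval (e i) f φ - eval (e i) h φ              ≡⟨ cong (_- eval (e i) h φ) (eq i m≤i) ⟩
          eval (e i) h φ - eval (e i) h φ              ≡⟨ ℚ.+-inverseʳ (eval (e i) h φ) ⟩
          0ℚ ∎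

  toℚᵘ-/1 : ∀ i → toℚᵘ (i / 1) ℚᵘ.≃ i ℚᵘ./ 1
  toℚᵘ-/1 i = ℚ.toℚᵘ-fromℚᵘ (i ℚᵘ./ 1)

  fromℕℚ-+ : ∀ a b → fromℕℚ (a ℕ.+ b) ≡ fromℕℚ a + fromℕℚ b
  fromℕℚ-+ a b = ℚ.toℚᵘ-injective (ℚᵘ.≃-trans (toℚᵘ-/1 (ℤ.+ (a ℕ.+ b))) (ℚᵘ.≃-trans
    (ℚᵘ.*≡* (cong (ℤ._* ℤ.+ 1) (cong₂ ℤ._+_ (sym (ℤ.*-identityʳ (ℤ.+ a))) (sym (ℤ.*-identityʳ (ℤ.+ b))))))
    (ℚᵘ.≃-sym (ℚᵘ.≃-trans (ℚ.toℚᵘ-homo-+ (fromℕℚ a) (fromℕℚ b))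
      (ℚᵘ.+-cong (toℚᵘ-/1 (ℤ.+ a)) (toℚᵘ-/1 (ℤ.+ b)))))))

  fromℕℚ-* : ∀ a b → fromℕℚ (a ℕ.* b) ≡ fromℕℚ a * fromℕℚ b
  fromℕℚ-* a b = ℚ.toℚᵘ-injective (ℚᵘ.≃-trans (toℚᵘ-/1 (ℤ.+ (a ℕ.* b))) (ℚᵘ.≃-trans
    (ℚᵘ.*≡* (cong (ℤ._* ℤ.+ 1) (ℤ.pos-* a b)))
    (ℚᵘ.≃-sym (ℚᵘ.≃-trans (ℚ.toℚᵘ-homo-* (fromℕℚ a) (fromℕℚ b))
      (ℚᵘ.*-cong (toℚᵘ-/1 (ℤ.+ a)) (toℚᵘ-/1 (ℤ.+ b)))))))

  fromℕℚ-injective : ∀ {a b} → fromℕℚ a ≡ fromℕℚ b → a ≡ b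
  fromℕℚ-injective {a} {b} eq with ℚ.fromℚᵘ-injective {ℤ.+ a ℚᵘ./ 1} {ℤ.+ b ℚᵘ./ 1} eq
  ... | ℚᵘ.*≡* eq′ = ℤ.+-injective (ℤ.*-cancelʳ-≡ (ℤ.+ a) (ℤ.+ b) (ℤ.+ 1) eq′)

  1/k*k≡1 : ∀ k .{{_ : ℕ.NonZero k}} → ℤ.+ 1 / k * fromℕℚ k ≡ 1ℚ
  1/k*k≡1 zero {{nz}} = contradiction refl (ℕ.≢-nonZero⁻¹ 0 {{nz}})
  1/k*k≡1 (suc k) = ℚ.toℚᵘ-injective (ℚᵘ.≃-trans (ℚ.toℚᵘ-homo-* (ℤ.+ 1 / suc k) (fromℕℚ (suc k)))
    (ℚᵘ.≃-trans (ℚᵘ.*-cong (ℚ.toℚᵘ-fromℚᵘ (ℚᵘ.mkℚᵘ (ℤ.+ 1) k)) (toℚᵘ-/1 (ℤ.+ suc k)))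
      (ℚᵘ.*≡* (ℤ.*-assoc (ℤ.+ 1) (ℤ.+ suc k) (ℤ.+ 1)))))

  ∑ : List X → (X → ℚ) → ℚ
  ∑ xs F = foldr (λ x r → F x + r) 0ℚ xs

  ∑-cong : ∀ (xs : List X) {F H} → (∀ x → F x ≡ H x) → ∑ xs F ≡ ∑ xs H
  ∑-cong []       eq = refl
  ∑-cong (x ∷ xs) eq = cong₂ _+_ (eq x) (∑-cong xs eq)

  -- Over the one-element monoid a functional is a single number. This puts the rational polynomials
  -- `falling` and `binomial` under the same rules of evaluation as the elements of the group
  -- algebra.
  ℚ-interpretation : Interpretation +-*-rawRing (Terminal.monoid {0ℓ} {0ℓ})
  ℚ-interpretation = record
    { ⟦_⟧       = λ s φ → s * φ _
    ; ⟦⟧-cong   = λ s eq → cong (s *_) (eq _)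
    ; ⟦⟧-linear = λ r s φ χ → solve 4 (λ r s f h → r :* (f :+ s :* h) := r :* f :+ s :* (r :* h))
                                refl r s (φ _) (χ _)
    ; +-homo    = λ r s φ → ℚ.*-distribʳ-+ (φ _) r s
    ; *-homo    = λ r s φ → ℚ.*-assoc r s (φ _)
    ; -‿homo    = λ r φ → sym (ℚ.neg-distribˡ-* r (φ _))
    ; 0-homo    = λ φ → ℚ.*-zeroˡ (φ _)
    ; 1-homo    = λ φ → ℚ.*-identityˡ (φ _)
    }

  fallingℚ : ℚ → ℕ → ℚ
  fallingℚ s zero    = 1ℚ
  fallingℚ s (suc k) = fallingℚ s k * (s - fromℕℚ k)

  binomialℚ : ℚ → ℕ → ℚ
  binomialℚ s k = (ℤ.+ 1 / (k !)) {{k ℕ.!≢0}} * fallingℚ s k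

  module _ (p : ℚ) where
    private
      module E = Evaluation ℚ-interpretation p
      module J = Interpretation E.interpretation

    const-value : ∀ s → J.IsScalar (ℚ[x].const s) s
    const-value s = E.scalar-const (Interpretation.isScalar (λ _ _ → refl))

    falling-value : ∀ {f s} → J.IsScalar f s → ∀ k → J.IsScalar (falling f k) (fallingℚ s k)
    falling-value sf zero    = J.scalar-1
    falling-value sf (suc k) =
      J.scalar-* (falling-value sf k) (J.scalar-+ sf (J.scalar-neg (const-value (fromℕℚ k))))

    binomial-value : ∀ {f s} → J.IsScalar f s → ∀ k → J.IsScalar (binomial f k) (binomialℚ s k)
    binomial-value sf k = J.scalar-* (const-value ((ℤ.+ 1 / (k !)) {{k ℕ.!≢0}})) (falling-value sf k)

  module _ (G : Group g ℓ′) (_≟_ : Decidable (Group._≈_ G)) where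
    private
      module G = Group G
      module A = GroupAlgebra +-*-rawRing G _≟_
      module AR = RawRing A.rawRing

    δ : G.Carrier → G.Carrier → ℚ
    δ h u = if does (u ≟ h) then 1ℚ else 0ℚ

    private
      ⟦_⟧ : A.FormalSum → (G.Carrier → ℚ) → ℚ
      ⟦ f ⟧ φ = ∑ f (λ (s , u) → s * φ u)

      linear : ∀ f s φ χ → ⟦ f ⟧ (λ u → φ u + s * χ u) ≡ ⟦ f ⟧ φ + s * ⟦ f ⟧ χ
      linear []            s φ χ = solve 1 (λ s → con 0ℚ := con 0ℚ :+ s :* con 0ℚ) refl s
      linear ((r , u) ∷ f) s φ χ = trans (cong (r * (φ u + s * χ u) +_) (linear f s φ χ))
        (solve 6 (λ r s a b x y → r :* (a :+ s :* b) :+ (x :+ s :* y)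
                                := (r :* a :+ x) :+ s :* (r :* b :+ y)) refl
           r s (φ u) (χ u) (⟦ f ⟧ φ) (⟦ f ⟧ χ))

      add : ∀ e f φ → ⟦ e ++ f ⟧ φ ≡ ⟦ e ⟧ φ + ⟦ f ⟧ φ
      add []            f φ = sym (ℚ.+-identityˡ _)
      add ((s , u) ∷ e) f φ = trans (cong (s * φ u +_) (add e f φ)) (sym (ℚ.+-assoc (s * φ u) (⟦ e ⟧ φ) (⟦ f ⟧ φ)))

      neg : ∀ f φ → ⟦ AR.- f ⟧ φ ≡ - ⟦ f ⟧ φ
      neg []            φ = refl
      neg ((s , u) ∷ f) φ = trans (cong ((- s) * φ u +_) (neg f φ))
        (solve 3 (λ s a x → (:- s) :* a :+ (:- x) := :- (s :* a :+ x)) refl s (φ u) (⟦ f ⟧ φ))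

      scale : ∀ s u f φ → ⟦ List.map (λ (t , v) → s * t , u G.∙ v) f ⟧ φ ≡ s * ⟦ f ⟧ (λ v → φ (u G.∙ v))
      scale s u []            φ = sym (ℚ.*-zeroʳ s)
      scale s u ((t , v) ∷ f) φ = trans (cong (s * t * φ (u G.∙ v) +_) (scale s u f φ))
        (solve 4 (λ s t a x → s :* t :* a :+ s :* x := s :* (t :* a :+ x)) refl
          s t (φ (u G.∙ v)) (⟦ f ⟧ (λ v → φ (u G.∙ v))))

      mul : ∀ e f φ → ⟦ e AR.* f ⟧ φ ≡ ⟦ e ⟧ (λ u → ⟦ f ⟧ (λ v → φ (u G.∙ v)))
      mul []            f φ = refl
      mul ((s , u) ∷ e) f φ = trans (add (List.map (λ (t , v) → s * t , u G.∙ v) f) (e AR.* f) φ)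
        (cong₂ _+_ (scale s u f φ) (mul e f φ))

    groupAlgebra-interpretation : Interpretation A.rawRing G.monoid
    groupAlgebra-interpretation = record
      { ⟦_⟧       = ⟦_⟧
      ; ⟦⟧-cong   = λ f eq → ∑-cong f (λ (s , u) → cong (s *_) (eq u))
      ; ⟦⟧-linear = linear
      ; +-homo    = add
      ; *-homo    = mul
      ; -‿homo    = neg
      ; 0-homo    = λ _ → refl
      ; 1-homo    = λ φ → trans (ℚ.+-identityʳ _) (ℚ.*-identityˡ _)
      }

    coeffAt≡⟦⟧δ : ∀ h f → A.coeffAt h f ≡ ⟦ f ⟧ (δ h)
    coeffAt≡⟦⟧δ h []            = refl
    coeffAt≡⟦⟧δ h ((s , u) ∷ f) with does (u ≟ h)
    ... | true  = cong₂ _+_ (sym (ℚ.*-identityʳ s)) (coeffAt≡⟦⟧δ h f)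
    ... | false = trans (coeffAt≡⟦⟧δ h f)
      (sym (trans (cong (_+ ⟦ f ⟧ (δ h)) (ℚ.*-zeroʳ s)) (ℚ.+-identityˡ _)))

  module PsiEvaluation (n : ℕ) where
    open Psi n using (module A; module A[x]; module A[x,y]; term; ψ; constant; scalar; x; y; _⟪_⟫)
    private
      module G = Group (𝔅 n)
      module AR = RawRing A[x,y].rawRing

    I₀ : Interpretation A.rawRing G.monoid
    I₀ = groupAlgebra-interpretation (𝔅 n) _≟𝔅_

    module I₀ = Interpretation I₀
    module E₁ (p : ℚ) = Evaluation I₀ p
    module I₁ (p : ℚ) = Interpretation (E₁.interpretation p)
    module E₂ (p q : ℚ) = Evaluation (E₁.interpretation p) q
    module I₂ (p q : ℚ) = Interpretation (E₂.interpretation p q)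

    weight : ℚ → SignedPerm n → ℚ
    weight p π = binomialℚ (p + fromℕℚ n - fromℕℚ (ades π)) n

    private
      -- All coefficients sit at π, so φ enters only through the number φ π and the evaluation is
      -- one over the one-element monoid.
      eval-singles : ∀ p f π φ → E₁.eval p (List.map (λ s → A.single s π) f) φ
                               ≡ Evaluation.eval ℚ-interpretation p f (λ _ → φ π)
      eval-singles p []      π φ = refl
      eval-singles p (s ∷ f) π φ = cong₂ (λ z w → z + p * w) (ℚ.+-identityʳ (s * φ π)) (eval-singles p f π φ)

    eval-term : ∀ p π φ → E₁.eval p (term π) φ ≡ weight p π * φ π
    eval-term p π φ = trans (eval-singles p (binomial z n) π φ)
      (J.apply (binomial-value p (J.scalar-+
          (J.scalar-+ (Evaluation.scalar-var ℚ-interpretation p) (const-value p (fromℕℚ n)))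
          (J.scalar-neg (const-value p (fromℕℚ (ades π)))))
        n) (λ _ → φ π) (λ _ → refl))
      where
      module J = Interpretation (Evaluation.interpretation ℚ-interpretation p)
      z = ℚ[x].var ℚ[x].+ ℚ[x].const (fromℕℚ n) ℚ[x].+ ℚ[x].- ℚ[x].const (fromℕℚ (ades π))

    eval-sum : ∀ p πs φ → E₁.eval p (foldr A[x]._+ₚ_ [] (List.map term πs)) φ
                        ≡ ∑ πs (λ π → weight p π * φ π)
    eval-sum p []       φ = refl
    eval-sum p (π ∷ πs) φ = trans (I₁.+-homo p (term π) _ φ) (cong₂ _+_ (eval-term p π φ) (eval-sum p πs φ))

    eval-ψ : ∀ p φ → E₁.eval p ψ φ ≡ ∑ (signedPerms n) (λ π → weight p π * φ π)
    eval-ψ p = eval-sum p (signedPerms n)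

    scalar-scalar : ∀ p q s → I₂.IsScalar p q (scalar s) s
    scalar-scalar p q s = E₂.scalar-const p q (E₁.scalar-const p
      (I₀.isScalar (λ φ _ → ℚ.+-identityʳ (s * φ G.ε))))

    scalar-x : ∀ p q → I₂.IsScalar p q x p
    scalar-x p q = E₂.scalar-const p q (E₁.scalar-var p)

    scalar-y : ∀ p q → I₂.IsScalar p q y q
    scalar-y p q = E₂.scalar-var p q

    -- Induction along the Horner scheme. A scalar `s` contributes its value c and the unit of the
    -- group, so `s * f ⟪ s ⟫` evaluates to c times the value of `f ⟪ s ⟫`; this is how the
    -- centrality of `s` is used.
    eval-substitute : ∀ p q {s c} → I₂.IsScalar p q s c → ∀ f φ → (∀ {u v} → u G.≈ v → φ u ≡ φ v) →
                      E₂.eval p q (f ⟪ s ⟫) φ ≡ E₁.eval c f φ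
    eval-substitute p q         sc []      φ φ-cong = refl
    eval-substitute p q {s} {c} sc (a ∷ f) φ φ-cong = begin
      E₂.eval p q (constant a AR.+ s AR.* f ⟪ s ⟫) φ
        ≡⟨ I₂.+-homo p q (constant a) (s AR.* f ⟪ s ⟫) φ ⟩
      E₂.eval p q (constant a) φ + E₂.eval p q (s AR.* f ⟪ s ⟫) φ
        ≡⟨ cong₂ _+_ (solve 3 (λ a p q → (a :+ p :* con 0ℚ) :+ q :* con 0ℚ := a) refl (I₀.⟦ a ⟧ φ) p q)
             (trans (I₂.*-homo p q s (f ⟪ s ⟫) φ)
               (I₂.apply sc _ (λ {u} {v} u≈v → I₂.⟦⟧-cong p q (f ⟪ s ⟫) (λ w → φ-cong (G.∙-congʳ {w} {u} {v} u≈v))))) ⟩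
      I₀.⟦ a ⟧ φ + c * E₂.eval p q (f ⟪ s ⟫) (λ v → φ (G.ε G.∙ v))
        ≡⟨ cong (λ z → I₀.⟦ a ⟧ φ + c * z) (trans
             (I₂.⟦⟧-cong p q (f ⟪ s ⟫) (λ v → φ-cong (G.identityˡ v)))
             (eval-substitute p q sc f φ φ-cong)) ⟩
      I₀.⟦ a ⟧ φ + c * E₁.eval c f φ ∎

-- Enumeration and number of chains with prescribed strict steps.

module Chains where
  open import Data.List.Base using (tabulate)
  open import Data.List.Membership.Propositional using (_∈_)
  open import Data.List.Relation.Unary.Unique.Propositional using () renaming (Unique to Uniqueₚ)
  open import Data.Nat.Base using (_+_; _∸_; _≤_)
  open import Data.Nat.Combinatorics using (_C_; nCk+nC[k+1]≡[n+1]C[k+1]; nCn≡1)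
  open import Data.Nat.Properties
  open import Data.Vec.Base using (lookup)

  private
    variable
      n : ℕ

  bit : Bool → ℕ
  bit b = if b then 1 else 0

  -- lo ≤ a₁ ≤ … ≤ aₙ ≤ hi, strictly where d and, for the last step, e hold.
  IsChain : (Fin n → Bool) → Bool → ℕ → ℕ → Vec ℕ n → Set
  IsChain {n} d e lo hi a =
    (∀ i → bit (d i) + lookup (lo ∷ a) (inject₁ i) ≤ lookup a i)
    × bit e + lookup (lo ∷ a) (fromℕ n) ≤ hi

  mutual
    chains : (Fin n → Bool) → Bool → (lo gap : ℕ) → List (Vec ℕ n)
    chains {zero}  d false lo g       = [] ∷ []
    chains {zero}  d true  lo zero    = []
    chains {zero}  d true  lo (suc g) = [] ∷ []
    chains {suc n} d e     lo g       = chains₁ (d zero) (d ∘ suc) e lo g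

    -- The first entry is either `lo` or at least `suc lo`. Strictness of the first step is a
    -- separate argument because a strict step from `lo` is a weak step from `suc lo`. With the
    -- upper end given as lo + gap, raising `lo` decreases `gap`, which makes the recursion
    -- structural.
    chains₁ : Bool → (Fin n → Bool) → Bool → (lo gap : ℕ) → List (Vec ℕ (suc n))
    chains₁ false d e lo zero    = map (lo ∷_) (chains d e lo zero)
    chains₁ false d e lo (suc g) = map (lo ∷_) (chains d e lo (suc g)) ++ chains₁ false d e (suc lo) g
    chains₁ true  d e lo zero    = []
    chains₁ true  d e lo (suc g) = chains₁ false d e (suc lo) g

  chain-≤ : ∀ (d : Fin n → Bool) e {lo hi} a → IsChain d e lo hi a → lo ≤ hi
  chain-≤ d e []      (_ , last)    = m+n≤o⇒n≤o (bit e) last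
  chain-≤ d e (v ∷ a) (steps , last) =
    ≤-trans (m+n≤o⇒n≤o (bit (d zero)) (steps zero)) (chain-≤ (d ∘ suc) e a (steps ∘ suc , last))

  ∷-chain : ∀ {d : Fin (suc n) → Bool} {e lo hi v a} → bit (d zero) + lo ≤ v →
            IsChain (d ∘ suc) e v hi a → IsChain d e lo hi (v ∷ a)
  ∷-chain first (steps , last) = (λ { zero → first ; (suc i) → steps i }) , last

  mutual
    chains-sound : ∀ (d : Fin n → Bool) e lo g {a} → a ∈ chains d e lo g → IsChain d e lo (lo + g) a
    chains-sound {zero}  d false lo g       (here refl) = (λ ()) , m≤m+n lo g
    chains-sound {zero}  d true  lo (suc g) (here refl) =
      (λ ()) , subst (suc lo ≤_) (sym (+-suc lo g)) (s≤s (m≤m+n lo g))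
    chains-sound {suc n} d e lo g {v ∷ a} a∈ with chains₁-sound (d zero) (d ∘ suc) e lo g a∈
    ... | first , chain = ∷-chain first chain

    chains₁-sound : ∀ b (d : Fin n → Bool) e lo g {v a} → v ∷ a ∈ chains₁ b d e lo g →
                    bit b + lo ≤ v × IsChain d e v (lo + g) a
    chains₁-sound false d e lo zero    va∈ with ∈-map⁻ (lo ∷_) va∈
    ... | _ , a∈ , refl = ≤-refl , chains-sound d e lo zero a∈
    chains₁-sound false d e lo (suc g) va∈ with ∈-++⁻ (map (lo ∷_) (chains d e lo (suc g))) va∈
    ... | inj₁ va∈₁ with ∈-map⁻ (lo ∷_) va∈₁
    ...   | _ , a∈ , refl = ≤-refl , chains-sound d e lo (suc g) a∈
    chains₁-sound false d e lo (suc g) {v} {a} va∈ | inj₂ va∈₂ with chains₁-sound false d e (suc lo) g va∈₂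
    ... | first , chain = <⇒≤ first , subst (λ hi → IsChain d e v hi a) (sym (+-suc lo g)) chain
    chains₁-sound true  d e lo (suc g) {v} {a} va∈ with chains₁-sound false d e (suc lo) g va∈
    ... | first , chain = first , subst (λ hi → IsChain d e v hi a) (sym (+-suc lo g)) chain

  mutual
    chains-complete : ∀ (d : Fin n → Bool) e lo g {a} → IsChain d e lo (lo + g) a → a ∈ chains d e lo g
    chains-complete {zero}  d false lo g       {[]} _ = here refl
    chains-complete {zero}  d true  lo zero    {[]} (_ , last) =
      contradiction (subst (suc lo ≤_) (+-identityʳ lo) last) 1+n≰n
    chains-complete {zero}  d true  lo (suc g) {[]} _ = here refl
    chains-complete {suc n} d e lo g {v ∷ a} (steps , last) =
      chains₁-complete (d zero) (d ∘ suc) e lo g (steps zero) (steps ∘ suc , last)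

    chains₁-complete : ∀ b (d : Fin n → Bool) e lo g {v a} → bit b + lo ≤ v →
                       IsChain d e v (lo + g) a → v ∷ a ∈ chains₁ b d e lo g
    chains₁-complete false d e lo zero {v} {a} lo≤v chain
      with ≤-antisym lo≤v (subst (v ≤_) (+-identityʳ lo) (chain-≤ d e a chain))
    ... | refl = ∈-map⁺ (lo ∷_) (chains-complete d e lo zero chain)
    chains₁-complete false d e lo (suc g) {v} {a} lo≤v chain with m≤n⇒m<n∨m≡n lo≤v
    ... | inj₂ refl = ∈-++⁺ˡ (∈-map⁺ (lo ∷_) (chains-complete d e lo (suc g) chain))
    ... | inj₁ lo<v = ∈-++⁺ʳ (map (lo ∷_) (chains d e lo (suc g)))
      (chains₁-complete false d e (suc lo) g lo<v (subst (λ hi → IsChain d e v hi a) (+-suc lo g) chain))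
    chains₁-complete true d e lo zero {v} {a} lo<v chain =
      contradiction (subst (v ≤_) (+-identityʳ lo) (chain-≤ d e a chain)) (<⇒≱ lo<v)
    chains₁-complete true d e lo (suc g) {v} {a} lo<v chain =
      chains₁-complete false d e (suc lo) g lo<v (subst (λ hi → IsChain d e v hi a) (+-suc lo g) chain)

  mutual
    chains-unique : ∀ (d : Fin n → Bool) e lo g → Uniqueₚ (chains d e lo g)
    chains-unique {zero}  d false lo g       = All.[] ∷ []
    chains-unique {zero}  d true  lo zero    = []
    chains-unique {zero}  d true  lo (suc g) = All.[] ∷ []
    chains-unique {suc n} d e     lo g       = chains₁-unique (d zero) (d ∘ suc) e lo g

    chains₁-unique : ∀ b (d : Fin n → Bool) e lo g → Uniqueₚ (chains₁ b d e lo g)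
    chains₁-unique false d e lo zero    = Uniqueₚ.map⁺ Vec.∷-injectiveʳ (chains-unique d e lo zero)
    chains₁-unique false d e lo (suc g) =
      Uniqueₚ.++⁺ (Uniqueₚ.map⁺ Vec.∷-injectiveʳ (chains-unique d e lo (suc g)))
        (chains₁-unique false d e (suc lo) g) disjoint
      where
      disjoint : ∀ {a} → a ∈ map (lo ∷_) (chains d e lo (suc g)) × a ∈ chains₁ false d e (suc lo) g → _
      disjoint {v ∷ a} (a∈₁ , a∈₂) with ∈-map⁻ (lo ∷_) a∈₁
      ... | _ , _ , refl = 1+n≰n (proj₁ (chains₁-sound false d e (suc lo) g a∈₂))
    chains₁-unique true  d e lo zero    = []
    chains₁-unique true  d e lo (suc g) = chains₁-unique false d e (suc lo) g

  -- The binomial coefficient of g - D + n over n, read as 0 if g < D.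
  chainCount : ℕ → ℕ → ℕ → ℕ
  chainCount n g       zero    = (g + n) C n
  chainCount n zero    (suc D) = 0
  chainCount n (suc g) (suc D) = chainCount n g D

  chainCount-≤ : ∀ n g {D} → D ≤ g → chainCount n g D ≡ (g ∸ D + n) C n
  chainCount-≤ n g       {zero}  _         = refl
  chainCount-≤ n (suc g) {suc D} (s≤s D≤g) = chainCount-≤ n g D≤g

  chainCount-zero : ∀ n D → chainCount (suc n) 0 D ≡ chainCount n 0 D
  chainCount-zero n zero    = trans (nCn≡1 (suc n)) (sym (nCn≡1 n))
  chainCount-zero n (suc D) = refl

  -- Pascal's rule, matching the case distinction of `chains₁`: the first entry is `lo`, or it is
  -- larger and the gap has shrunk by one.
  chainCount-suc : ∀ n g D →
    chainCount (suc n) (suc g) D ≡ chainCount n (suc g) D + chainCount (suc n) g D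
  chainCount-suc n g zero = begin
    suc (g + suc n) C suc n                    ≡⟨ nCk+nC[k+1]≡[n+1]C[k+1] (g + suc n) n ⟨
    (g + suc n) C n + (g + suc n) C suc n      ≡⟨ cong (λ z → z C n + (g + suc n) C suc n) (+-suc g n) ⟩
    (suc g + n) C n + (g + suc n) C suc n      ∎
    where open ≡-Reasoning
  -- At the edge of the truncation the last summand is 0, and the other two counts both equal 1.
  chainCount-suc n zero    (suc zero)    = trans (chainCount-zero n 0) (sym (+-identityʳ _))
  chainCount-suc n zero    (suc (suc D)) = refl
  chainCount-suc n (suc g) (suc D)       = chainCount-suc n g D

  #descents : (Fin n → Bool) → ℕ
  #descents {zero}  d = 0
  #descents {suc n} d = bit (d zero) + #descents (d ∘ suc)

  mutual
    -- Only the number of strict steps matters, not their places: each of them uses up one unit of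
    -- the gap.
    length-chains : ∀ (d : Fin n → Bool) e lo g → length (chains d e lo g) ≡ chainCount n g (#descents d + bit e)
    length-chains {zero}  d false lo g       = refl
    length-chains {zero}  d true  lo zero    = refl
    length-chains {zero}  d true  lo (suc g) = refl
    length-chains {suc n} d e lo g           =
      trans (length-chains₁ (d zero) (d ∘ suc) e lo g)
            (cong (chainCount (suc n) g) (sym (+-assoc (bit (d zero)) _ _)))

    length-chains₁ : ∀ b (d : Fin n → Bool) e lo g →
      length (chains₁ b d e lo g) ≡ chainCount (suc n) g (bit b + (#descents d + bit e))
    length-chains₁ {n} false d e lo zero = begin
      length (map (lo ∷_) (chains d e lo zero)) ≡⟨ List.length-map (lo ∷_) (chains d e lo zero) ⟩
      length (chains d e lo zero)               ≡⟨ length-chains d e lo zero ⟩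
      chainCount n 0 D                          ≡⟨ chainCount-zero n D ⟨
      chainCount (suc n) 0 D                    ∎
      where open ≡-Reasoning
            D = #descents d + bit e
    length-chains₁ {n} false d e lo (suc g) = begin
      length (map (lo ∷_) (chains d e lo (suc g)) ++ rest)
        ≡⟨ List.length-++ (map (lo ∷_) (chains d e lo (suc g))) ⟩
      length (map (lo ∷_) (chains d e lo (suc g))) + length rest
        ≡⟨ cong₂ _+_ (trans (List.length-map (lo ∷_) (chains d e lo (suc g))) (length-chains d e lo (suc g)))
                     (length-chains₁ false d e (suc lo) g) ⟩
      chainCount n (suc g) D + chainCount (suc n) g D
        ≡⟨ chainCount-suc n g D ⟨
      chainCount (suc n) (suc g) D ∎
      where open ≡-Reasoning
            D = #descents d + bit e
            rest = chains₁ false d e (suc lo) g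
    length-chains₁ true d e lo zero    = refl
    length-chains₁ true d e lo (suc g) = length-chains₁ false d e (suc lo) g

  length-filter-tabulate : ∀ {A : Set} {P : Pred A 0ℓ} (P? : Unary.Decidable P) (f : Fin n → A) →
    length (filter P? (tabulate f)) ≡ #descents (does ∘ P? ∘ f)
  length-filter-tabulate {zero}  P? f = refl
  length-filter-tabulate {suc n} P? f with does (P? (f zero))
  ... | true  = cong suc (length-filter-tabulate P? (f ∘ suc))
  ... | false = length-filter-tabulate P? (f ∘ suc)

  #descents-≤ : ∀ (d : Fin n → Bool) → #descents d ≤ n
  #descents-≤ {zero}  d = z≤n
  #descents-≤ {suc n} d with d zero
  ... | true  = s≤s (#descents-≤ (d ∘ suc))
  ... | false = m≤n⇒m≤1+n (#descents-≤ (d ∘ suc))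

  #descents-cong : ∀ {d d′ : Fin n → Bool} → (∀ i → d i ≡ d′ i) → #descents d ≡ #descents d′
  #descents-cong {zero}  eq = refl
  #descents-cong {suc n} eq = cong₂ (λ b r → bit b + r) (eq zero) (#descents-cong (eq ∘ suc))

-- Comparing lengths of duplicate-free lists over setoids.

module Cardinality where
  open import Data.List.Base using (lookup)

  private
    variable
      a b ℓ ℓ′ r : Level

  module _ (S : Setoid a ℓ) where
    open Setoid S using (_≈_) renaming (sym to ≈-sym)
    open Membership S using (_∈_)

    lookup-injective : ∀ {xs} → Unique S xs → ∀ i j → lookup xs i ≈ lookup xs j → i ≡ j
    lookup-injective {x ∷ xs} _          zero    zero    _  = refl
    lookup-injective {x ∷ xs} (x∉ ∷ _)   zero    (suc j) eq =
      contradiction eq (All.lookup x∉ (∈-lookup j))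
    lookup-injective {x ∷ xs} (x∉ ∷ _)   (suc i) zero    eq =
      contradiction (≈-sym eq) (All.lookup x∉ (∈-lookup i))
    lookup-injective {x ∷ xs} (_ ∷ u)    (suc i) (suc j) eq = cong suc (lookup-injective u i j eq)

  module _ (S : Setoid a ℓ) (T : Setoid b ℓ′) where
    private
      module S = Setoid S
      module T = Setoid T
      open Membership S using () renaming (_∈_ to _∈ₛ_)
      open Membership T using () renaming (_∈_ to _∈ₜ_)

    -- Injectivity on list indices. `R` is a relation and not a function so that the lemma also
    -- serves for the inverse of a bijection, where a preimage is available only from a proof of
    -- membership.
    length-≤ : ∀ {xs ys} (R : S.Carrier → T.Carrier → Set r) → Unique S xs →
               (∀ {x} → x ∈ₛ xs → ∃ λ y → y ∈ₜ ys × R x y) →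
               (∀ {x x′ y y′} → x ∈ₛ xs → x′ ∈ₛ xs → R x y → R x′ y′ → y T.≈ y′ → x S.≈ x′) →
               length xs ℕ.≤ length ys
    length-≤ {xs = xs} {ys} R xs! image injective = Fin.injective⇒≤ {f = f} λ {i} {j} eq →
      lookup-injective S xs! i j (injective (∈xs i) (∈xs j) (proj₂ (proj₂ (image (∈xs i))))
        (proj₂ (proj₂ (image (∈xs j)))) (Membershipₚ.index-injective T (f∈ i) (f∈ j) eq))
      where
      ∈xs : ∀ i → lookup xs i ∈ₛ xs
      ∈xs = Membershipₚ.∈-lookup S xs
      f∈ : ∀ i → proj₁ (image (∈xs i)) ∈ₜ ys
      f∈ i = proj₁ (proj₂ (image (∈xs i)))
      f : Fin (length xs) → Fin (length ys)
      f i = index (f∈ i)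

  module _ (S : Setoid a ℓ) (T : Setoid b ℓ′) where
    private
      module S = Setoid S
      module T = Setoid T
      open Membership S using () renaming (_∈_ to _∈ₛ_)
      open Membership T using () renaming (_∈_ to _∈ₜ_)

    length-bijection : ∀ {xs ys} (f : S.Carrier → T.Carrier) → Unique S xs → Unique T ys →
      (∀ {x x′} → x S.≈ x′ → f x T.≈ f x′) →
      (∀ {x} → x ∈ₛ xs → f x ∈ₜ ys) →
      (∀ {x x′} → x ∈ₛ xs → x′ ∈ₛ xs → f x T.≈ f x′ → x S.≈ x′) →
      (∀ {y} → y ∈ₜ ys → ∃ λ x → x ∈ₛ xs × f x T.≈ y) →
      length xs ≡ length ys
    length-bijection f xs! ys! f-cong f∈ f-injective f-surjective = ℕ.≤-antisym
      (length-≤ S T (λ x y → f x T.≈ y) xs! (λ {x} x∈ → f x , f∈ x∈ , T.refl)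
        λ x∈ x′∈ fx≈y fx′≈y′ y≈y′ →
          f-injective x∈ x′∈ (T.trans fx≈y (T.trans y≈y′ (T.sym fx′≈y′))))
      (length-≤ T S (λ y x → f x T.≈ y) ys! f-surjective
        λ _ _ fx≈y fx′≈y′ x≈x′ → T.trans (T.sym fx≈y) (T.trans (f-cong x≈x′) fx′≈y′))

-- Existence and uniqueness of sorting permutations.

module Sorted where
  private
    variable
      a ℓ ℓ₁ ℓ₂ : Level
      m : ℕ

  module _ {X : Set a} (_∼_ : Rel X ℓ) (∼-trans : Transitive _∼_) where
    adjacent⇒monotone : (k : Fin (suc m) → X) → (∀ i → k (inject₁ i) ∼ k (suc i)) →
                        ∀ {s t} → s Fin.< t → k s ∼ k t
    adjacent⇒monotone k step {s} {t} =
      <-weakInduction (λ t → ∀ s → s Fin.< t → k s ∼ k t) (λ _ ()) extend t s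
      where
      extend : ∀ i → (∀ s → s Fin.< inject₁ i → k s ∼ k (inject₁ i)) → ∀ s → s Fin.< suc i → k s ∼ k (suc i)
      extend i below s (s≤s s≤i) with ℕ.m≤n⇒m<n∨m≡n s≤i
      ... | inj₁ s<i = ∼-trans (below s (subst (Fin.toℕ s ℕ.<_) (sym (Fin.toℕ-inject₁ i)) s<i)) (step i)
      ... | inj₂ s≡i with Fin.toℕ-injective {i = s} {inject₁ i} (trans s≡i (sym (Fin.toℕ-inject₁ i)))
      ...   | refl = step i

  monotone⇒inflationary : (θ : Fin m → Fin m) → (∀ {s t} → s Fin.< t → θ s Fin.< θ t) → ∀ s → s Fin.≤ θ s
  monotone⇒inflationary {suc m} θ mono = <-weakInduction (λ s → s Fin.≤ θ s) z≤n λ i i≤θi →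
    ℕ.≤-trans (s≤s (subst (ℕ._≤ Fin.toℕ (θ (inject₁ i))) (Fin.toℕ-inject₁ i) i≤θi))
      (mono {inject₁ i} {suc i} (s≤s (ℕ.≤-reflexive (Fin.toℕ-inject₁ i))))

  module Sorting (O : StrictTotalOrder a ℓ₁ ℓ₂) where
    open StrictTotalOrder O using (Carrier; _≈_; _<_; compare; irrefl; asym)
      renaming (trans to <-trans; module Eq to Eq)

    Sorts : (Fin m → Carrier) → (Fin m → Fin m) → Set ℓ₂
    Sorts k ρ = ∀ {s t} → s Fin.< t → k (ρ s) < k (ρ t)

    minimum : (k : Fin (suc m) → Carrier) → ∃ λ i → ∀ s → ¬ (k s < k i)
    minimum {zero}  k = zero , λ { zero → irrefl Eq.refl }
    minimum {suc m} k with minimum (k ∘ suc)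
    ... | i , min with compare (k zero) (k (suc i))
    ...   | tri< k₀<kᵢ _ _ = zero , λ { zero → irrefl Eq.refl ; (suc s) kₛ<k₀ → min s (<-trans kₛ<k₀ k₀<kᵢ) }
    ...   | tri≈ k₀≮kᵢ _ _ = suc i , λ { zero → k₀≮kᵢ ; (suc s) → min s }
    ...   | tri> k₀≮kᵢ _ _ = suc i , λ { zero → k₀≮kᵢ ; (suc s) → min s }

    -- Selection sort: position `zero` receives the index of a minimal key and `punchIn` omits that
    -- index from the rest. Injectivity of the keys makes the resulting order strict.
    sort : (k : Fin m → Carrier) → (∀ {s t} → k s ≈ k t → s ≡ t) →
           ∃ λ (ρ : Permutation′ m) → Sorts k (ρ ⟨$⟩ʳ_)
    sort {zero}  k k-injective = Perm.id , λ { {()} }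
    sort {suc m} k k-injective with minimum k
    ... | i , min with sort (k ∘ punchIn i) (Fin.punchIn-injective i _ _ ∘ k-injective)
    ...   | ρ , ρ-sorts = insert zero i ρ , sorts
      where
      sorts : Sorts k (insert zero i ρ ⟨$⟩ʳ_)
      sorts {zero}  {suc t} _ with compare (k i) (k (punchIn i (ρ ⟨$⟩ʳ t)))
      ... | tri< lt _ _ = lt
      ... | tri≈ _ eq _ = contradiction (sym (k-injective eq)) (Fin.punchInᵢ≢i i _)
      ... | tri> _ _ gt = contradiction gt (min _)
      sorts {suc s} {suc t} (s≤s s<t) = ρ-sorts s<t

    private
      sorts-≤ : ∀ (k : Fin m → Carrier) (ρ ρ′ : Permutation′ m) → Sorts k (ρ ⟨$⟩ʳ_) → Sorts k (ρ′ ⟨$⟩ʳ_) →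
                ∀ s → s Fin.≤ ρ′ ⟨$⟩ˡ (ρ ⟨$⟩ʳ s)
      sorts-≤ k ρ ρ′ sorts sorts′ = monotone⇒inflationary (λ s → ρ′ ⟨$⟩ˡ (ρ ⟨$⟩ʳ s)) mono
        where
        θ = λ s → ρ′ ⟨$⟩ˡ (ρ ⟨$⟩ʳ s)
        mono : ∀ {s t} → s Fin.< t → θ s Fin.< θ t
        mono {s} {t} s<t with Fin.<-cmp (θ s) (θ t)
        ... | tri< lt _ _ = lt
        ... | tri≈ _ eq _ = contradiction (sorts s<t)
          (irrefl (Eq.reflexive (cong k (trans (sym (inverseʳ ρ′)) (trans (cong (ρ′ ⟨$⟩ʳ_) eq) (inverseʳ ρ′))))))
        ... | tri> _ _ gt = contradiction (sorts s<t)
          (asym (subst₂ (λ u v → k u < k v) (inverseʳ ρ′) (inverseʳ ρ′) (sorts′ gt)))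

    -- The map ρ′⁻¹ρ preserves <, since a reversal or a tie would contradict the order of the keys
    -- along ρ. It is therefore inflationary, and so is its inverse by symmetry; together they force
    -- the identity.
    sorts-unique : ∀ {k : Fin m → Carrier} (ρ ρ′ : Permutation′ m) →
                   Sorts k (ρ ⟨$⟩ʳ_) → Sorts k (ρ′ ⟨$⟩ʳ_) → ∀ s → ρ ⟨$⟩ʳ s ≡ ρ′ ⟨$⟩ʳ s
    sorts-unique {k = k} ρ ρ′ sorts sorts′ s = trans (sym (inverseʳ ρ′)) (cong (ρ′ ⟨$⟩ʳ_) θs≡s)
      where
      θs≡s : ρ′ ⟨$⟩ˡ (ρ ⟨$⟩ʳ s) ≡ s
      θs≡s = Fin.≤-antisym
        (subst (ρ′ ⟨$⟩ˡ (ρ ⟨$⟩ʳ s) Fin.≤_) (trans (cong (ρ ⟨$⟩ˡ_) (inverseʳ ρ′)) (inverseˡ ρ)) (sorts-≤ k ρ′ ρ sorts′ sorts _))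
        (sorts-≤ k ρ ρ′ sorts sorts′ s)

-- Odd sequences sorted by a signed permutation, and their composition.

module SignedSequences where
  open import Data.Integer.Base using (+_; -_; _+_; _*_; _-_; 0ℤ; 1ℤ)
  open import Data.Integer.Solver using (module +-*-Solver)
  open +-*-Solver using (solve; _:+_; _:*_; :-_; _:-_; con; _:=_)
  open import Data.Vec.Base using (lookup; tabulate)
  open Chains using (bit; IsChain)
  open Sorted

  opposite-antitone : ∀ {m} {s t : Fin m} → s Fin.< t → opposite t Fin.< opposite s
  opposite-antitone {m} {s} {t} s<t =
    subst₂ ℕ._<_ (sym (Fin.opposite-prop t)) (sym (Fin.opposite-prop s))
      (ℕ.∸-monoʳ-< (s≤s s<t) (Fin.toℕ<n t))

  level : ℕ → ℤ → ℤ → ℤ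
  level j b x = (+ j + + j) * b + x

  level-neg : ∀ j b x → - level j b x ≡ level j (- b) (- x)
  level-neg j b x = solve 3 (λ J b x → :- ((J :+ J) :* b :+ x) := (J :+ J) :* (:- b) :+ (:- x)) refl (+ j) b x

  module _ {n : ℕ} where
    private
      N = n ℕ.+ suc n
      o = origin {n}
      module G = Group (𝔅 n)

    open StrictTotalOrder (×-strictTotalOrder ℤ.<-strictTotalOrder (Fin.<-strictTotalOrder N)) public
      using () renaming (_<_ to _≺_; trans to ≺-trans; compare to ≺-compare; irrefl to ≺-irrefl; asym to ≺-asym)
    open Sorting (×-strictTotalOrder ℤ.<-strictTotalOrder (Fin.<-strictTotalOrder N))

    opposite-origin : opposite o ≡ o
    opposite-origin = Fin.toℕ-injective (begin
      Fin.toℕ (opposite o)              ≡⟨ Fin.opposite-prop o ⟩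
      n ℕ.+ suc n ℕ.∸ suc (Fin.toℕ o)   ≡⟨ cong (λ z → n ℕ.+ suc n ℕ.∸ suc z) o≡n ⟩
      n ℕ.+ suc n ℕ.∸ suc n             ≡⟨ ℕ.m+n∸n≡m n (suc n) ⟩
      n                                 ≡⟨ o≡n ⟨
      Fin.toℕ o                         ∎)
      where
      open ≡-Reasoning
      o≡n : Fin.toℕ o ≡ n
      o≡n = trans (Fin.toℕ-↑ʳ n zero) (ℕ.+-identityʳ n)

    ≺-neg : ∀ {x y s t} → (x , s) ≺ (y , t) → (- y , opposite t) ≺ (- x , opposite s)
    ≺-neg (inj₁ x<y)          = inj₁ (ℤ.neg-mono-< x<y)
    ≺-neg (inj₂ (x≡y , s<t)) = inj₂ (cong -_ (sym x≡y) , opposite-antitone s<t)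

    ≤∧<⇒≺ : ∀ {x y s t} → x ℤ.≤ y → s Fin.< t → (x , s) ≺ (y , t)
    ≤∧<⇒≺ {x} {y} x≤y s<t with ℤ.<-cmp x y
    ... | tri< x<y _ _ = inj₁ x<y
    ... | tri≈ _ x≡y _ = inj₂ (x≡y , s<t)
    ... | tri> _ _ y<x = contradiction x≤y (ℤ.<⇒≱ y<x)

    ≺⇒≤ : ∀ {x y s t} → (x , s) ≺ (y , t) → x ℤ.≤ y
    ≺⇒≤ (inj₁ x<y)       = ℤ.<⇒≤ x<y
    ≺⇒≤ (inj₂ (x≡y , _)) = ℤ.≤-reflexive x≡y

    perm-origin : ∀ (σ : SignedPerm n) → SignedPerm.perm σ ⟨$⟩ʳ o ≡ o
    perm-origin (signed σ odd) = fixed (trans (cong (σ ⟨$⟩ʳ_) (sym opposite-origin)) (odd o))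
      where
      fixed : ∀ {s} → s ≡ opposite s → s ≡ o
      fixed {s} s≡ with Fin.<-cmp s o
      ... | tri< lt _ _ = contradiction (subst₂ Fin._<_ opposite-origin (sym s≡) (opposite-antitone lt)) (ℕ.<-asym lt)
      ... | tri≈ _ eq _ = eq
      ... | tri> _ _ gt = contradiction (subst₂ Fin._<_ (sym s≡) opposite-origin (opposite-antitone gt)) (ℕ.<-asym gt)

    infixl 7 _·_
    _·_ : SignedPerm n → Fin N → Fin N
    σ · s = SignedPerm.perm σ ⟨$⟩ʳ s

    -- (−j , 0) ≺ (x , t) ≺ (j , 0): in absolute value x is at most j, and equality forces the
    -- sign of t to be opposite to that of x.
    Window : ℕ → ℤ × Fin N → Set
    Window j u = (- + j , o) ≺ u × u ≺ (+ j , o)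

    window-neg : ∀ {j x t} → Window j (x , t) → Window j (- x , opposite t)
    window-neg {j} {x} {t} (lower , upper) =
      subst (λ s → (- + j , s) ≺ (- x , opposite t)) opposite-origin (≺-neg upper) ,
      subst₂ (λ y s → (- x , opposite t) ≺ (y , s)) (ℤ.neg-involutive (+ j)) opposite-origin (≺-neg lower)

    -- The largest value over b is 2jb + j, which is 2j(b + 1) - j and so at most the smallest value
    -- over b′. Where the two endpoints coincide, the windows force t < o on the left and o < t′ on
    -- the right, and the second components decide.
    level-< : ∀ {j b b′ x x′ t t′} → Window j (x , t) → Window j (x′ , t′) → b ℤ.< b′ →
              (level j b x , t) ≺ (level j b′ x′ , t′)
    level-< {j} {b} {b′} {x} {x′} (_ , upper) (lower , _) b<b′ = compare upper lower
      where
      J = + j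
      jump : level j b J ℤ.≤ level j b′ (- J)
      jump = begin
        (J + J) * b + J            ≡⟨ solve 2 (λ J b → (J :+ J) :* b :+ J := (J :+ J) :* (con 1ℤ :+ b) :+ (:- J)) refl J b ⟩
        (J + J) * (1ℤ + b) + - J   ≤⟨ ℤ.+-monoˡ-≤ (- J) (ℤ.*-monoˡ-≤-nonNeg (J + J) (ℤ.i<j⇒suc[i]≤j b<b′)) ⟩
        (J + J) * b′ + - J         ∎
        where open ℤ.≤-Reasoning
      compare : (x , _) ≺ (J , o) → (- J , o) ≺ (x′ , _) → (level j b x , _) ≺ (level j b′ x′ , _)
      compare (inj₁ x<J) lower =
        inj₁ (ℤ.<-≤-trans (ℤ.+-monoʳ-< ((J + J) * b) x<J) (ℤ.≤-trans jump (ℤ.+-monoʳ-≤ ((J + J) * b′) (≺⇒≤ lower))))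
      compare (inj₂ (refl , _)) (inj₁ -J<x′) =
        inj₁ (ℤ.≤-<-trans jump (ℤ.+-monoʳ-< ((J + J) * b′) -J<x′))
      compare (inj₂ (refl , t<o)) (inj₂ (refl , o<t′)) = ≤∧<⇒≺ jump (ℕ.<-trans t<o o<t′)

    -- For a common t, unequal b and b′ would give strictly ordered pairs by `level-<`, against
    -- equality of the values.
    level-injective : ∀ {j b b′ x x′ t} → Window j (x , t) → Window j (x′ , t) →
                      level j b x ≡ level j b′ x′ → b ≡ b′ × x ≡ x′
    level-injective {j} {b} {b′} {x} {x′} w w′ eq with ℤ.<-cmp b b′
    ... | tri< b<b′ _ _ = contradiction (level-< w w′ b<b′) (≺-irrefl (eq , refl))
    ... | tri≈ _ refl _ = refl , GroupProperties.∙-cancelˡ (AbelianGroup.group ℤ.+-0-abelianGroup) ((+ j + + j) * b) x x′ eq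
    ... | tri> _ _ b′<b = contradiction (level-< w′ w b′<b) (≺-irrefl (sym eq , refl))

    module _ {j : ℕ} .{{_ : ℕ.NonZero j}} where
      private
        J = + j

      level-surjective-pos : ∀ {t} → o Fin.< t → ∀ z → ∃₂ λ b x → z ≡ level j b x × Window j (x , t)
      level-surjective-pos {t} o<t z =
        b , x , eq , (≤∧<⇒≺ -J≤x o<t , inj₁ x<J)
        where
        d = j ℕ.+ j
        instance
          d≢0 : ℕ.NonZero d
          d≢0 = ℕ.>-nonZero (ℕ.<-≤-trans (ℕ.>-nonZero⁻¹ j) (ℕ.m≤m+n j j))
        -- Shifting by j before dividing moves the remainder from [0 , 2j) to [-j , j). The endpoint
        -- -j lies in the window because o < t.
        b = (z + J) ℤ./ℕ d
        r = + ((z + J) ℤ.%ℕ d)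
        x = r - J
        eq : z ≡ level j b x
        eq = begin
          z                           ≡⟨ solve 2 (λ z J → z := (z :+ J) :- J) refl z J ⟩
          (z + J) - J                 ≡⟨ cong (_- J) (ℤ.a≡a%ℕn+[a/ℕn]*n (z + J) d) ⟩
          (r + b * (J + J)) - J       ≡⟨ solve 3 (λ r b J → (r :+ b :* (J :+ J)) :- J := (J :+ J) :* b :+ (r :- J)) refl r b J ⟩
          (J + J) * b + (r - J)       ∎
          where open ≡-Reasoning
        -J≤x : - J ℤ.≤ x
        -J≤x = subst (ℤ._≤ x) (ℤ.+-identityˡ (- J)) (ℤ.+-monoˡ-≤ (- J) (ℤ.+≤+ z≤n))
        x<J : x ℤ.< J
        x<J = subst (x ℤ.<_) (solve 1 (λ J → (J :+ J) :- J := J) refl J)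
          (ℤ.+-monoˡ-< (- J) (ℤ.+<+ (ℤ.n%ℕd<d (z + J) d)))

      -- For t < o the case o < t is negated, which exchanges the roles of -j and j. At t = o the
      -- window excludes both endpoints, so an odd multiple of j would have no decomposition there;
      -- an odd sequence takes the value 0 at that place.
      level-surjective : ∀ t z → (t ≡ o → z ≡ 0ℤ) → ∃₂ λ b x → z ≡ level j b x × Window j (x , t)
      level-surjective t z z≡0 with Fin.<-cmp t o
      ... | tri> _ _ o<t  = level-surjective-pos o<t z
      ... | tri≈ _ t≡o _ = 0ℤ , 0ℤ , trans (z≡0 t≡o) (sym (trans (ℤ.+-identityʳ _) (ℤ.*-zeroʳ (J + J)))) ,
        inj₁ (ℤ.neg-mono-< 0<J) , inj₁ 0<J
        where
        0<J : 0ℤ ℤ.< J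
        0<J = ℤ.+<+ (ℕ.>-nonZero⁻¹ j)
      ... | tri< t<o _ _
        with level-surjective-pos (subst (Fin._< opposite t) opposite-origin (opposite-antitone t<o)) (- z)
      ...   | b , x , eq , w = - b , - x ,
        trans (sym (ℤ.neg-involutive z)) (trans (cong -_ eq) (level-neg j b x)) ,
        subst (λ s → Window j (- x , s)) (Fin.opposite-involutive t) (window-neg w)

    record Valid (j : ℕ) (σ : SignedPerm n) (A : Fin N → ℤ) : Set where
      field
        odd   : ∀ s → A (opposite s) ≡ - A s
        sorts : ∀ {s t} → s Fin.< t → (A s , σ · s) ≺ (A t , σ · t)
        bound : ∀ s → (A s , σ · s) ≺ (+ j , o)

      window : ∀ s → Window j (A s , σ · s)
      window s = subst₂ (λ x t → Window j (x , t))
        (trans (cong -_ (odd s)) (ℤ.neg-involutive (A s)))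
        (trans (cong opposite (SignedPerm.isOdd σ s)) (Fin.opposite-involutive (σ · s)))
        (window-neg (lower , bound (opposite s)))
        where
        lower : (- + j , o) ≺ (A (opposite s) , σ · opposite s)
        lower = subst₂ _≺_ (cong (- + j ,_) opposite-origin)
          (cong₂ _,_ (sym (odd s)) (sym (SignedPerm.isOdd σ s))) (≺-neg (bound s))

      A-origin : A o ≡ 0ℤ
      A-origin = self-neg (trans (cong A (sym opposite-origin)) (odd o))
        where
        self-neg : ∀ {x} → x ≡ - x → x ≡ 0ℤ
        self-neg {+ zero}    _  = refl
        self-neg {+ suc x}   ()
        self-neg {ℤ.-[1+ x ]} ()

      -- Different b are separated by the windows, and for equal b the order is that of the pairs of
      -- A. Both the validity of composites and, by totality, the converse statement `reflect` rest
      -- on this.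
      level-mono : ∀ {b b′ s t} → (b , s) ≺ (b′ , t) →
                   (level j b (A s) , σ · s) ≺ (level j b′ (A t) , σ · t)
      level-mono {s = s} {t} (inj₁ b<b′) = level-< (window s) (window t) b<b′
      level-mono {b} {s = s} {t} (inj₂ (refl , s<t)) with sorts s<t
      ... | inj₁ As<At         = inj₁ (ℤ.+-monoʳ-< ((+ j + + j) * b) As<At)
      ... | inj₂ (As≡At , lt) = inj₂ (cong (level j b) As≡At , lt)

    open Valid

    Valid-resp : ∀ {j σ σ′ A A′} → σ G.≈ σ′ → A ≗ A′ → Valid j σ A → Valid j σ′ A′
    Valid-resp {j} σ≈σ′ A≗A′ v = record
      { odd   = λ s → trans (sym (A≗A′ (opposite s))) (trans (odd v s) (cong -_ (A≗A′ s)))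
      ; sorts = λ {s} {t} s<t → subst₂ _≺_ (cong₂ _,_ (A≗A′ s) (σ≈σ′ s)) (cong₂ _,_ (A≗A′ t) (σ≈σ′ t)) (sorts v s<t)
      ; bound = λ s → subst (_≺ (+ j , o)) (cong₂ _,_ (A≗A′ s) (σ≈σ′ s)) (bound v s)
      }

    composite : ℕ → (Fin N → ℤ) → SignedPerm n → (Fin N → ℤ) → Fin N → ℤ
    composite j A τ B s = level j (B s) (A (τ · s))

    module _ {j k : ℕ} where
      -- The bound (k , o) for B is itself a pair to which `level-mono` applies. Its image is the
      -- bound for the composite, since A vanishes and σ is fixed at the origin.
      level-top : ∀ {σ A} → Valid j σ A → (level j (+ k) (A o) , σ · o) ≡ (+ (2 ℕ.* j ℕ.* k) , o)
      level-top {σ} {A} v = cong₂ _,_ (begin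
        (+ j + + j) * + k + A o    ≡⟨ cong (λ z → (+ j + + j) * + k + z) (A-origin v) ⟩
        + (j ℕ.+ j) * + k + 0ℤ     ≡⟨ ℤ.+-identityʳ _ ⟩
        + (j ℕ.+ j) * + k          ≡⟨ ℤ.pos-* (j ℕ.+ j) k ⟨
        + ((j ℕ.+ j) ℕ.* k)        ≡⟨ cong (λ z → + ((j ℕ.+ z) ℕ.* k)) (ℕ.+-identityʳ j) ⟨
        + (2 ℕ.* j ℕ.* k)          ∎) (perm-origin σ)
        where open ≡-Reasoning

      composite-valid : ∀ {σ τ A B} → Valid j σ A → Valid k τ B →
                        Valid (2 ℕ.* j ℕ.* k) (σ G.∙ τ) (composite j A τ B)
      composite-valid {σ} {τ} {A} {B} vA vB = record
        { odd   = λ s → trans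
            (cong₂ (level j) (odd vB s) (trans (cong A (SignedPerm.isOdd τ s)) (odd vA (τ · s))))
            (sym (level-neg j (B s) (A (τ · s))))
        ; sorts = λ s<t → level-mono vA (sorts vB s<t)
        ; bound = λ s → subst ((composite j A τ B s , σ · (τ · s)) ≺_) (level-top vA) (level-mono vA (bound vB s))
        }

    -- The decomposition of each value with second component σ(τ s) is unique, so B = B′ and A ∘ τ =
    -- A′ ∘ τ′. With στ = σ′τ′ this gives A ∘ σ⁻¹ = A′ ∘ σ′⁻¹: both permutations sort the same `key`
    -- and thus agree.
    composite-injective : ∀ {j k k′ σ σ′ τ τ′ A A′ B B′} →
      Valid j σ A → Valid j σ′ A′ → Valid k τ B → Valid k′ τ′ B′ → σ G.∙ τ G.≈ σ′ G.∙ τ′ →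
      composite j A τ B ≗ composite j A′ τ′ B′ → σ G.≈ σ′ × A ≗ A′ × B ≗ B′
    composite-injective {j} {σ = σ} {σ′} {τ} {τ′} {A} {A′} {B} {B′} vA vA′ vB vB′ στ≈σ′τ′ eq =
      σ≈σ′ , A≗A′ , λ s → proj₁ (components s)
      where
      open ≡-Reasoning
      components : ∀ s → B s ≡ B′ s × A (τ · s) ≡ A′ (τ′ · s)
      components s = level-injective (window vA (τ · s))
        (subst (λ t → Window j (A′ (τ′ · s) , t)) (sym (στ≈σ′τ′ s)) (window vA′ (τ′ · s))) (eq s)

      key : Fin N → ℤ × Fin N
      key t = A (σ G.⁻¹ · t) , t

      A-σ : ∀ s → A (σ G.⁻¹ · (σ · s)) ≡ A s
      A-σ s = cong A (inverseˡ (SignedPerm.perm σ))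

      A-σ′ : ∀ s → A (σ G.⁻¹ · (σ′ · s)) ≡ A′ s
      A-σ′ s = begin
        A (σ G.⁻¹ · (σ′ · s))           ≡⟨ cong (λ t → A (σ G.⁻¹ · (σ′ · t))) (inverseʳ (SignedPerm.perm τ′)) ⟨
        A (σ G.⁻¹ · (σ′ · (τ′ · u)))    ≡⟨ cong (λ t → A (σ G.⁻¹ · t)) (στ≈σ′τ′ u) ⟨
        A (σ G.⁻¹ · (σ · (τ · u)))      ≡⟨ A-σ (τ · u) ⟩
        A (τ · u)                       ≡⟨ proj₂ (components u) ⟩
        A′ (τ′ · u)                     ≡⟨ cong A′ (inverseʳ (SignedPerm.perm τ′)) ⟩
        A′ s                            ∎
        where u = τ′ G.⁻¹ · s

      σ≈σ′ : σ G.≈ σ′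
      σ≈σ′ = sorts-unique {k = key} (SignedPerm.perm σ) (SignedPerm.perm σ′)
        (λ {s} {t} s<t → subst₂ _≺_ (cong (_, σ · s) (sym (A-σ s))) (cong (_, σ · t) (sym (A-σ t))) (sorts vA s<t))
        (λ {s} {t} s<t → subst₂ _≺_ (cong (_, σ′ · s) (sym (A-σ′ s))) (cong (_, σ′ · t) (sym (A-σ′ t))) (sorts vA′ s<t))

      A≗A′ : A ≗ A′
      A≗A′ s = trans (sym (A-σ s)) (trans (cong (λ t → A (σ G.⁻¹ · t)) (σ≈σ′ s)) (A-σ′ s))

    composite-surjective : ∀ {j k π C} .{{_ : ℕ.NonZero j}} → Valid (2 ℕ.* j ℕ.* k) π C →
      ∃ λ σ → ∃₂ λ A B → Valid j σ A × Valid k (σ G.⁻¹ G.∙ π) B × composite j A (σ G.⁻¹ G.∙ π) B ≗ C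
    composite-surjective {j} {k} {π} {C} vC = σ , A , B , vA , vB , eq
      where
      π′ = SignedPerm.perm π
      -- C is reindexed by the value t = π s, because it is the sign of t that selects the residue.
      C′ : Fin N → ℤ
      C′ t = C (π G.⁻¹ · t)

      decompose : ∀ t → ∃₂ λ b x → C′ t ≡ level j b x × Window j (x , t)
      decompose t = level-surjective t (C′ t) λ { refl →
        trans (cong C (perm-origin (π G.⁻¹))) (A-origin vC) }

      b x : Fin N → ℤ
      b t = proj₁ (decompose t)
      x t = proj₁ (proj₂ (decompose t))
      C′≡ : ∀ t → C′ t ≡ level j (b t) (x t)
      C′≡ t = proj₁ (proj₂ (proj₂ (decompose t)))
      w : ∀ t → Window j (x t , t)
      w t = proj₂ (proj₂ (proj₂ (decompose t)))

      -- Negating the decomposition at t gives one at `opposite t`, so uniqueness applies.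
      decompose-odd : ∀ t → b (opposite t) ≡ - b t × x (opposite t) ≡ - x t
      decompose-odd t = level-injective (w (opposite t)) (window-neg (w t)) (begin
        level j (b (opposite t)) (x (opposite t)) ≡⟨ C′≡ (opposite t) ⟨
        C′ (opposite t)                           ≡⟨ cong C (SignedPerm.isOdd (π G.⁻¹) t) ⟩
        C (opposite (π G.⁻¹ · t))                 ≡⟨ odd vC _ ⟩
        - C′ t                                    ≡⟨ cong -_ (C′≡ t) ⟩
        - level j (b t) (x t)                     ≡⟨ level-neg j (b t) (x t) ⟩
        level j (- b t) (- x t)                   ∎)
        where open ≡-Reasoning

      key : Fin N → ℤ × Fin N
      key t = x t , t

      key-opposite : ∀ t → key (opposite t) ≡ (- x t , opposite t)
      key-opposite t = cong (_, opposite t) (proj₂ (decompose-odd t))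

      sorted : ∃ λ ρ → Sorts key (ρ ⟨$⟩ʳ_)
      sorted = sort key proj₂
      ρ : Permutation′ N
      ρ = proj₁ sorted

      -- The keys are odd and negation reverses ≺, so conjugating ρ by the reversal gives another
      -- permutation that sorts them.
      ρ-odd : ∀ s → opposite (ρ ⟨$⟩ʳ opposite s) ≡ ρ ⟨$⟩ʳ s
      ρ-odd = sorts-unique {k = key} (Perm.reverse ∘ₚ ρ ∘ₚ Perm.reverse) ρ
        (λ {s} {t} s<t → subst₂ _≺_ (sym (key-opposite _)) (sym (key-opposite _))
          (≺-neg (proj₂ sorted (opposite-antitone s<t))))
        (proj₂ sorted)

      σ : SignedPerm n
      σ = signed ρ λ s → trans (sym (Fin.opposite-involutive _)) (cong opposite (ρ-odd s))

      A B : Fin N → ℤ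
      A s = x (ρ ⟨$⟩ʳ s)
      B s = b (π · s)

      vA : Valid j σ A
      vA = record
        { odd   = λ s → trans (cong x (SignedPerm.isOdd σ s)) (proj₂ (decompose-odd (σ · s)))
        ; sorts = proj₂ sorted
        ; bound = λ s → proj₂ (w (σ · s))
        }

      τ : SignedPerm n
      τ = σ G.⁻¹ G.∙ π

      στ : ∀ s → σ · (τ · s) ≡ π · s
      στ s = inverseʳ ρ

      eq : composite j A τ B ≗ C
      eq s = begin
        level j (b (π · s)) (x (σ · (τ · s)))  ≡⟨ cong (λ t → level j (b (π · s)) (x t)) (στ s) ⟩
        level j (b (π · s)) (x (π · s))        ≡⟨ C′≡ (π · s) ⟨
        C (π G.⁻¹ · (π · s))                   ≡⟨ cong C (inverseˡ π′) ⟩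
        C s                                    ∎
        where open ≡-Reasoning

      -- Since level-mono preserves ≺, it also reflects it, the order being total.
      reflect : ∀ {b₁ b₂ s t} → (level j b₁ (A s) , σ · s) ≺ (level j b₂ (A t) , σ · t) → (b₁ , s) ≺ (b₂ , t)
      reflect {b₁} {b₂} {s} {t} lt with ≺-compare (b₁ , s) (b₂ , t)
      ... | tri< lt′ _ _         = lt′
      ... | tri≈ _ (refl , refl) _ = contradiction lt (≺-irrefl (refl , refl))
      ... | tri> _ _ gt          = contradiction (level-mono vA gt) (≺-asym lt)

      here-eq : ∀ s → (C s , π · s) ≡ (level j (B s) (A (τ · s)) , σ · (τ · s))
      here-eq s = sym (cong₂ _,_ (eq s) (στ s))

      vB : Valid k τ B
      vB = record
        { odd   = λ s → trans (cong b (SignedPerm.isOdd π s)) (proj₁ (decompose-odd (π · s)))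
        ; sorts = λ {s} {t} s<t → reflect (subst₂ _≺_ (here-eq s) (here-eq t) (sorts vC s<t))
        ; bound = λ s → reflect (subst₂ _≺_ (here-eq s) (sym (level-top {j} {k} vA)) (bound vC s))
        }

  module _ {n : ℕ} where
    private
      N = n ℕ.+ suc n
      o = origin {n}
      module G = Group (𝔅 n)

    open Valid

    pos : Fin (suc n) → Fin N
    pos i = n ↑ʳ i

    opposite-↑ˡ : ∀ (i : Fin n) → opposite (i ↑ˡ suc n) ≡ pos (suc (opposite i))
    opposite-↑ˡ i = Fin.toℕ-injective (begin
      Fin.toℕ (opposite (i ↑ˡ suc n))               ≡⟨ Fin.opposite-prop (i ↑ˡ suc n) ⟩
      n ℕ.+ suc n ℕ.∸ suc (Fin.toℕ (i ↑ˡ suc n))    ≡⟨ cong (λ z → n ℕ.+ suc n ℕ.∸ suc z) (Fin.toℕ-↑ˡ i (suc n)) ⟩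
      n ℕ.+ suc n ℕ.∸ suc (Fin.toℕ i)               ≡⟨ cong (ℕ._∸ suc (Fin.toℕ i)) (ℕ.+-comm n (suc n)) ⟩
      suc n ℕ.+ n ℕ.∸ suc (Fin.toℕ i)               ≡⟨ ℕ.+-∸-assoc (suc n) (Fin.toℕ<n i) ⟩
      suc n ℕ.+ (n ℕ.∸ suc (Fin.toℕ i))             ≡⟨ ℕ.+-suc n _ ⟨
      n ℕ.+ suc (n ℕ.∸ suc (Fin.toℕ i))             ≡⟨ cong (λ z → n ℕ.+ suc z) (Fin.opposite-prop i) ⟨
      n ℕ.+ suc (Fin.toℕ (opposite i))              ≡⟨ Fin.toℕ-↑ʳ n (suc (opposite i)) ⟨
      Fin.toℕ (n ↑ʳ suc (opposite i))               ∎)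
      where open ≡-Reasoning

    -- Negative places are presented as opposites of positive ones, so that oddness can be applied
    -- to them directly.
    data Sign : Fin N → Set where
      nonneg : ∀ i → Sign (pos i)
      neg    : ∀ i → Sign (opposite (pos (suc i)))

    sign : ∀ s → Sign s
    sign s with splitAt n s in eq
    ... | inj₁ i = subst Sign (trans (cong opposite (sym (opposite-↑ˡ i)))
                     (trans (Fin.opposite-involutive _) (Fin.splitAt⁻¹-↑ˡ eq))) (neg (opposite i))
    ... | inj₂ i = subst Sign (Fin.splitAt⁻¹-↑ʳ eq) (nonneg i)

    pos-< : ∀ {i k} → pos i Fin.< pos k → i Fin.< k
    pos-< {i} {k} lt = ℕ.+-cancelˡ-< n _ _ (subst₂ ℕ._<_ (Fin.toℕ-↑ʳ n i) (Fin.toℕ-↑ʳ n k) lt)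

    pos-<⁺ : ∀ {i k} → i Fin.< k → pos i Fin.< pos k
    pos-<⁺ {i} {k} lt = subst₂ ℕ._<_ (sym (Fin.toℕ-↑ʳ n i)) (sym (Fin.toℕ-↑ʳ n k)) (ℕ.+-monoʳ-< n lt)

    neg<origin : ∀ i → opposite (pos (suc i)) Fin.< o
    neg<origin i = subst (opposite (pos (suc i)) Fin.<_) opposite-origin
      (opposite-antitone (pos-<⁺ {zero} {suc i} (s≤s z≤n)))

    -- Index i of the lower half encodes i - n. Its absolute value n - i belongs to the entry of `a`
    -- with index n - i - 1, which is `opposite i`.
    extend : Vec ℕ n → Fin N → ℤ
    extend a s = [ (λ i → - + lookup a (opposite i)) , (λ i → + lookup (0 ∷ a) i) ]′ (splitAt n s)

    extend-pos : ∀ a i → extend a (pos i) ≡ + lookup (0 ∷ a) i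
    extend-pos a i = cong [ _ , _ ]′ (Fin.splitAt-↑ʳ n (suc n) i)

    extend-neg : ∀ a i → extend a (opposite (pos (suc i))) ≡ - + lookup a i
    extend-neg a i = begin
      extend a (opposite (pos (suc i)))                       ≡⟨ cong (extend a ∘ opposite ∘ pos ∘ suc) (Fin.opposite-involutive i) ⟨
      extend a (opposite (pos (suc (opposite (opposite i))))) ≡⟨ cong (extend a ∘ opposite) (opposite-↑ˡ (opposite i)) ⟨
      extend a (opposite (opposite (opposite i ↑ˡ suc n)))    ≡⟨ cong (extend a) (Fin.opposite-involutive _) ⟩
      extend a (opposite i ↑ˡ suc n)                          ≡⟨ cong [ _ , _ ]′ (Fin.splitAt-↑ˡ n (opposite i) (suc n)) ⟩
      - + lookup a (opposite (opposite i))                    ≡⟨ cong (λ z → - + lookup a z) (Fin.opposite-involutive i) ⟩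
      - + lookup a i                                          ∎
      where open ≡-Reasoning

    extend-odd : ∀ a s → extend a (opposite s) ≡ - extend a s
    extend-odd a s with sign s
    ... | nonneg zero = begin
      extend a (opposite o)  ≡⟨ cong (extend a) opposite-origin ⟩
      extend a o             ≡⟨ extend-pos a zero ⟩
      0ℤ                     ≡⟨ cong -_ (extend-pos a zero) ⟨
      - extend a o           ∎
      where open ≡-Reasoning
    ... | nonneg (suc i) = trans (extend-neg a i) (cong -_ (sym (extend-pos a (suc i))))
    ... | neg i = begin
      extend a (opposite (opposite (pos (suc i))))  ≡⟨ cong (extend a) (Fin.opposite-involutive _) ⟩
      extend a (pos (suc i))                        ≡⟨ extend-pos a (suc i) ⟩
      + lookup a i                                  ≡⟨ ℤ.neg-involutive (+ lookup a i) ⟨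
      - - + lookup a i                              ≡⟨ cong -_ (extend-neg a i) ⟨
      - extend a (opposite (pos (suc i)))           ∎
      where open ≡-Reasoning

    extend-unique : ∀ {A} a → (∀ s → A (opposite s) ≡ - A s) →
                    (∀ i → A (pos i) ≡ + lookup (0 ∷ a) i) → extend a ≗ A
    extend-unique a A-odd A-pos s with sign s
    ... | nonneg i = trans (extend-pos a i) (sym (A-pos i))
    ... | neg i    = trans (extend-neg a i) (sym (trans (A-odd (pos (suc i))) (cong -_ (A-pos (suc i)))))

    extend-injective : ∀ {a a′} → extend a ≗ extend a′ → a ≡ a′
    extend-injective {a} {a′} eq = begin
      a                     ≡⟨ Vec.tabulate∘lookup a ⟨
      tabulate (lookup a)   ≡⟨ Vec.tabulate-cong (λ i → ℤ.+-injective
                                 (trans (sym (extend-pos a (suc i))) (trans (eq (pos (suc i))) (extend-pos a′ (suc i))))) ⟩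
      tabulate (lookup a′)  ≡⟨ Vec.tabulate∘lookup a′ ⟩
      a′                    ∎
      where open ≡-Reasoning

    restrict : (Fin N → ℤ) → Vec ℕ n
    restrict A = tabulate (λ i → ℤ.∣ A (pos (suc i)) ∣)

    -- The absolute values in `restrict` lose nothing: A is weakly increasing and vanishes at the
    -- origin, hence is nonnegative at positive places.
    extend-restrict : ∀ {j σ A} → Valid j σ A → extend (restrict A) ≗ A
    extend-restrict {A = A} v = extend-unique (restrict A) (odd v) λ
      { zero    → A-origin v
      ; (suc i) → sym (trans (cong +_ (Vec.lookup∘tabulate _ i))
                    (ℤ.0≤i⇒+∣i∣≡i (subst (ℤ._≤ A (pos (suc i))) (A-origin v)
                      (≺⇒≤ {n} (sorts v (pos-<⁺ {zero} {suc i} (s≤s z≤n)))))))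
      }

    ≺⇒bit≤ : ∀ {x y} {s t : Fin N} (t<?s : Dec (t Fin.< s)) → (+ x , s) ≺ (+ y , t) →
             bit (does t<?s) ℕ.+ x ℕ.≤ y
    ≺⇒bit≤ (yes _)   (inj₁ (ℤ.+<+ x<y)) = x<y
    ≺⇒bit≤ (no  _)   (inj₁ (ℤ.+<+ x<y)) = ℕ.<⇒≤ x<y
    ≺⇒bit≤ (yes t<s) (inj₂ (_ , s<t))   = contradiction s<t (ℕ.<-asym t<s)
    ≺⇒bit≤ (no  _)   (inj₂ (refl , _))  = ℕ.≤-refl

    -- When t < s fails, the hypothesis s ≢ t leaves s < t, which settles the tie x = y.
    bit≤⇒≺ : ∀ {x y} {s t : Fin N} (t<?s : Dec (t Fin.< s)) → s ≢ t →
             bit (does t<?s) ℕ.+ x ℕ.≤ y → (+ x , s) ≺ (+ y , t)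
    bit≤⇒≺ (yes _)   s≢t x<y = inj₁ (ℤ.+<+ x<y)
    bit≤⇒≺ (no  t≮s) s≢t x≤y = ≤∧<⇒≺ {n} (ℤ.+≤+ x≤y) (Fin.≤∧≢⇒< (ℕ.≮⇒≥ t≮s) s≢t)

    descent : SignedPerm n → Fin n → Bool
    descent σ i = does (valueAt σ (suc i) Fin.<? valueAt σ (inject₁ i))

    -- An augmented descent at n is a descent from π(n) to 0, as though the bound (j , o) were one
    -- more point after the last.
    lastDescent : SignedPerm n → Bool
    lastDescent σ = does (o Fin.<? valueAt σ (fromℕ n))

    IsChainFor : ℕ → SignedPerm n → Vec ℕ n → Set
    IsChainFor j σ = IsChain (descent σ) (lastDescent σ) 0 j

    valueAt-injective : ∀ σ {i k} → valueAt σ i ≡ valueAt σ k → i ≡ k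
    valueAt-injective σ {i} {k} eq = Fin.↑ʳ-injective n i k
      (trans (sym (inverseˡ (SignedPerm.perm σ))) (trans (cong (SignedPerm.perm σ ⟨$⟩ˡ_) eq) (inverseˡ (SignedPerm.perm σ))))

    module _ (j : ℕ) (σ : SignedPerm n) (a : Vec ℕ n) where
      private
        point : Fin (suc n) → ℤ × Fin N
        point i = + lookup (0 ∷ a) i , valueAt σ i

        point≡ : ∀ i → point i ≡ (extend a (pos i) , σ · pos i)
        point≡ i = cong (_, σ · pos i) (sym (extend-pos a i))

      valid⇒chain : Valid j σ (extend a) → IsChainFor j σ a
      valid⇒chain v =
        (λ i → ≺⇒bit≤ (_ Fin.<? _) (subst₂ _≺_ (sym (point≡ (inject₁ i))) (sym (point≡ (suc i)))
                 (sorts v (pos-<⁺ (s≤s (ℕ.≤-reflexive (Fin.toℕ-inject₁ i))))))) ,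
        ≺⇒bit≤ (_ Fin.<? _) (subst (_≺ (+ j , o)) (sym (point≡ (fromℕ n))) (bound v (pos (fromℕ n))))

      -- Transitivity extends the steps between neighbours to all nonnegative places, negation
      -- carries them to the negative places, and the two halves are linked through the origin.
      chain⇒valid : .{{_ : ℕ.NonZero n}} → IsChainFor j σ a → Valid j σ (extend a)
      chain⇒valid (steps , last) = record
        { odd   = extend-odd a
        ; sorts = extend-sorts
        ; bound = extend-bound
        }
        where
        step : ∀ i → point (inject₁ i) ≺ point (suc i)
        step i = bit≤⇒≺ (_ Fin.<? _)
          (λ eq → Fin.<⇒≢ {i = inject₁ i} {suc i} (s≤s (ℕ.≤-reflexive (Fin.toℕ-inject₁ i)))
                    (valueAt-injective σ eq))
          (steps i)

        point-sorts : ∀ {i k} → i Fin.< k → point i ≺ point k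
        point-sorts = adjacent⇒monotone _≺_ ≺-trans point step

        -- As n is nonzero, place n is not the origin, so by injectivity its value is not the origin
        -- either and no tie with o arises.
        point-last : point (fromℕ n) ≺ (+ j , o)
        point-last = bit≤⇒≺ (_ Fin.<? _) (λ eq → ℕ.≢-nonZero⁻¹ n (trans (sym (Fin.toℕ-fromℕ n))
          (cong Fin.toℕ (valueAt-injective σ (trans eq (sym (perm-origin σ))))))) last

        point-bound : ∀ i → point i ≺ (+ j , o)
        point-bound i with Fin.<-cmp i (fromℕ n)
        ... | tri< lt _ _   = ≺-trans (point-sorts lt) point-last
        ... | tri≈ _ refl _ = point-last
        ... | tri> _ _ gt   = contradiction (Fin.≤fromℕ i) (ℕ.<⇒≱ gt)

        value : Fin N → ℤ × Fin N
        value s = extend a s , σ · s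

        value-opposite : ∀ s → value (opposite s) ≡ (- extend a s , opposite (σ · s))
        value-opposite s = cong₂ _,_ (extend-odd a s) (SignedPerm.isOdd σ s)

        value-neg : ∀ i → value (opposite (pos (suc i))) ≺ value o
        value-neg i = subst₂ _≺_ (sym (value-opposite (pos (suc i))))
          (trans (sym (value-opposite o)) (cong value opposite-origin))
          (≺-neg (subst₂ _≺_ (point≡ zero) (point≡ (suc i)) (point-sorts {zero} {suc i} (s≤s z≤n))))

        extend-bound : ∀ s → value s ≺ (+ j , o)
        extend-bound s with sign s
        ... | nonneg i = subst (_≺ (+ j , o)) (point≡ i) (point-bound i)
        ... | neg i    = ≺-trans (value-neg i) (subst (_≺ (+ j , o)) (point≡ zero) (point-bound zero))

        extend-sorts : ∀ {s t} → s Fin.< t → value s ≺ value t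
        extend-sorts {s} {t} s<t with sign s | sign t
        ... | nonneg i | nonneg k = subst₂ _≺_ (point≡ i) (point≡ k) (point-sorts (pos-< s<t))
        ... | nonneg i | neg k    = contradiction (pos-< {i} {zero} (ℕ.<-trans s<t (neg<origin k))) λ ()
        ... | neg i    | nonneg zero    = value-neg i
        ... | neg i    | nonneg (suc k) = ≺-trans (value-neg i)
          (subst₂ _≺_ (point≡ zero) (point≡ (suc k)) (point-sorts {zero} {suc k} (s≤s z≤n)))
        ... | neg i    | neg k    = subst₂ _≺_ (sym (value-opposite (pos (suc i)))) (sym (value-opposite (pos (suc k))))
          (≺-neg (subst₂ _≺_ (point≡ (suc k)) (point≡ (suc i)) (point-sorts (pos-< k<i))))
          where
          k<i : pos (suc k) Fin.< pos (suc i)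
          k<i = subst₂ Fin._<_ (Fin.opposite-involutive _) (Fin.opposite-involutive _) (opposite-antitone s<t)

-- Binomial weights as numbers of chains, and the bijection on triples.

module Counting where
  open import Data.Nat.Combinatorics using (_C_; nCk+nC[k+1]≡[n+1]C[k+1]; nCn≡1; nCk≡nC[n∸k]; k>n⇒nCk≡0)
  open import Data.List.Membership.Propositional using (_∈_)
  open import Data.Rational.Base using (_+_; _*_; -_; _-_)
  open import Data.Rational.Solver using (module +-*-Solver)
  open +-*-Solver using (solve; _:+_; _:*_; :-_; _:-_; con; _:=_)
  open ℚ[x] using (fromℕℚ)
  open Evaluations
  open Chains
  open Cardinality
  open SignedSequences

  fromℕℚ-suc : ∀ m → fromℕℚ (suc m) ≡ 1ℚ + fromℕℚ m
  fromℕℚ-suc = fromℕℚ-+ 1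

  fallingℚ-suc : ∀ m k → fallingℚ (fromℕℚ (suc m)) (suc k) ≡ fromℕℚ (suc m) * fallingℚ (fromℕℚ m) k
  fallingℚ-suc m zero    = solve 1 (λ m → con 1ℚ :* (m :- con 0ℚ) := m :* con 1ℚ) refl (fromℕℚ (suc m))
  fallingℚ-suc m (suc k) = begin
    fallingℚ (fromℕℚ (suc m)) (suc k) * (fromℕℚ (suc m) - fromℕℚ (suc k))
      ≡⟨ cong₂ _*_ (fallingℚ-suc m k) (cong₂ _-_ (fromℕℚ-suc m) (fromℕℚ-suc k)) ⟩
    M * F * ((1ℚ + fromℕℚ m) - (1ℚ + fromℕℚ k))
      ≡⟨ solve 4 (λ M F m k → M :* F :* ((con 1ℚ :+ m) :- (con 1ℚ :+ k)) := M :* (F :* (m :- k)))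
           refl M F (fromℕℚ m) (fromℕℚ k) ⟩
    M * (F * (fromℕℚ m - fromℕℚ k)) ∎
    where
    open ≡-Reasoning
    M = fromℕℚ (suc m)
    F = fallingℚ (fromℕℚ m) k

  fallingℚ-zero : ∀ k → fallingℚ 0ℚ (suc k) ≡ 0ℚ
  fallingℚ-zero zero    = refl
  fallingℚ-zero (suc k) = trans (cong (_* (0ℚ - fromℕℚ (suc k))) (fallingℚ-zero k)) (ℚ.*-zeroˡ (0ℚ - fromℕℚ (suc k)))

  -- Pascal's rule: with F the falling factorial of m of length k, the two summands are (k + 1)F and
  -- (m - k)F, with sum (m + 1)F.
  C*!≡falling : ∀ k m → fromℕℚ (m C k) * fromℕℚ (k !) ≡ fallingℚ (fromℕℚ m) k
  C*!≡falling zero    m       = cong (λ z → fromℕℚ z * 1ℚ) (trans (nCk≡nC[n∸k] {n = m} z≤n) (nCn≡1 m))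
  C*!≡falling (suc k) zero    = begin
    fromℕℚ (0 C suc k) * fromℕℚ (suc k !)  ≡⟨ cong (λ z → fromℕℚ z * fromℕℚ (suc k !)) (k>n⇒nCk≡0 {0} {suc k} (s≤s z≤n)) ⟩
    0ℚ * fromℕℚ (suc k !)                  ≡⟨ ℚ.*-zeroˡ (fromℕℚ (suc k !)) ⟩
    0ℚ                                     ≡⟨ fallingℚ-zero k ⟨
    fallingℚ 0ℚ (suc k)                    ∎
    where open ≡-Reasoning
  C*!≡falling (suc k) (suc m) = begin
    fromℕℚ (suc m C suc k) * fromℕℚ (suc k !)
      ≡⟨ cong (λ z → fromℕℚ z * fromℕℚ (suc k !)) (nCk+nC[k+1]≡[n+1]C[k+1] m k) ⟨
    fromℕℚ (m C k ℕ.+ m C suc k) * fromℕℚ (suc k !)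
      ≡⟨ cong (_* fromℕℚ (suc k !)) (fromℕℚ-+ (m C k) (m C suc k)) ⟩
    (fromℕℚ (m C k) + fromℕℚ (m C suc k)) * fromℕℚ (suc k !)
      ≡⟨ ℚ.*-distribʳ-+ (fromℕℚ (suc k !)) (fromℕℚ (m C k)) (fromℕℚ (m C suc k)) ⟩
    fromℕℚ (m C k) * fromℕℚ (suc k !) + fromℕℚ (m C suc k) * fromℕℚ (suc k !)
      ≡⟨ cong₂ _+_ (cong (fromℕℚ (m C k) *_) (fromℕℚ-* (suc k) (k !))) (C*!≡falling (suc k) m) ⟩
    fromℕℚ (m C k) * (fromℕℚ (suc k) * fromℕℚ (k !)) + F * (fromℕℚ m - fromℕℚ k)
      ≡⟨ cong (_+ F * (fromℕℚ m - fromℕℚ k))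
           (solve 3 (λ c s f → c :* (s :* f) := s :* (c :* f)) refl (fromℕℚ (m C k)) (fromℕℚ (suc k)) (fromℕℚ (k !))) ⟩
    fromℕℚ (suc k) * (fromℕℚ (m C k) * fromℕℚ (k !)) + F * (fromℕℚ m - fromℕℚ k)
      ≡⟨ cong₂ (λ s c → s * c + F * (fromℕℚ m - fromℕℚ k)) (fromℕℚ-suc k) (C*!≡falling k m) ⟩
    (1ℚ + fromℕℚ k) * F + F * (fromℕℚ m - fromℕℚ k)
      ≡⟨ solve 3 (λ k m F → (con 1ℚ :+ k) :* F :+ F :* (m :- k) := (con 1ℚ :+ m) :* F) refl (fromℕℚ k) (fromℕℚ m) F ⟩
    (1ℚ + fromℕℚ m) * F
      ≡⟨ cong (_* F) (fromℕℚ-suc m) ⟨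
    fromℕℚ (suc m) * F
      ≡⟨ fallingℚ-suc m k ⟨
    fallingℚ (fromℕℚ (suc m)) (suc k) ∎
    where
    open ≡-Reasoning
    F = fallingℚ (fromℕℚ m) k

  binomialℚ≡C : ∀ m k → binomialℚ (fromℕℚ m) k ≡ fromℕℚ (m C k)
  binomialℚ≡C m k = begin
    1/k! * fallingℚ (fromℕℚ m) k              ≡⟨ cong (1/k! *_) (C*!≡falling k m) ⟨
    1/k! * (fromℕℚ (m C k) * fromℕℚ (k !))    ≡⟨ solve 3 (λ r c f → r :* (c :* f) := r :* f :* c) refl 1/k! (fromℕℚ (m C k)) (fromℕℚ (k !)) ⟩
    1/k! * fromℕℚ (k !) * fromℕℚ (m C k)      ≡⟨ cong (_* fromℕℚ (m C k)) (1/k*k≡1 (k !) {{k ℕ.!≢0}}) ⟩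
    1ℚ * fromℕℚ (m C k)                       ≡⟨ ℚ.*-identityˡ _ ⟩
    fromℕℚ (m C k)                            ∎
    where
    open ≡-Reasoning
    1/k! = (ℤ.+ 1 / (k !)) {{k ℕ.!≢0}}

  length-cartesianProduct : ∀ {A B : Set} (xs : List A) (ys : List B) →
                            length (cartesianProduct xs ys) ≡ length xs ℕ.* length ys
  length-cartesianProduct []       ys = refl
  length-cartesianProduct (x ∷ xs) ys = trans (List.length-++ (map (x ,_) ys))
    (cong₂ ℕ._+_ (List.length-map (x ,_) ys) (length-cartesianProduct xs ys))

  module _ {n : ℕ} where
    private
      module G = Group (𝔅 n)
    open PsiEvaluation n using (weight)

    chainsFor : ℕ → SignedPerm n → List (Vec ℕ n)
    chainsFor j σ = chains (descent σ) (lastDescent σ) 0 j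

    -- The order polynomial of σ in the sense of signed P-partitions, as a counting function of j.
    Ω : ℕ → SignedPerm n → ℕ
    Ω j σ = length (chainsFor j σ)

    ades≡ : ∀ (σ : SignedPerm n) → ades σ ≡ #descents (descent σ) ℕ.+ bit (lastDescent σ)
    ades≡ σ = cong (ℕ._+ bit (lastDescent σ))
      (length-filter-tabulate (λ i → valueAt σ (suc i) Fin.<? valueAt σ (inject₁ i)) id)

    ades-cong : ∀ {σ τ : SignedPerm n} → σ G.≈ τ → ades σ ≡ ades τ
    ades-cong {σ} {τ} σ≈τ = trans (ades≡ σ) (trans (cong₂ ℕ._+_
      (#descents-cong λ i → cong₂ (λ s t → does (s Fin.<? t)) (σ≈τ (n Fin.↑ʳ suc i)) (σ≈τ (n Fin.↑ʳ inject₁ i)))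
      (cong (λ s → bit (does (origin Fin.<? s))) (σ≈τ _))) (sym (ades≡ τ)))

    ades-≤ : ∀ (σ : SignedPerm n) → ades σ ℕ.≤ suc n
    ades-≤ σ = begin
      ades σ                                             ≡⟨ ades≡ σ ⟩
      #descents (descent σ) ℕ.+ bit (lastDescent σ)      ≤⟨ ℕ.+-mono-≤ (#descents-≤ (descent σ)) (bit-≤ (lastDescent σ)) ⟩
      n ℕ.+ 1                                            ≡⟨ ℕ.+-comm n 1 ⟩
      suc n                                              ∎
      where
      open ℕ.≤-Reasoning
      bit-≤ : ∀ b → bit b ℕ.≤ 1
      bit-≤ true  = ℕ.≤-refl
      bit-≤ false = z≤n

    -- From j ≥ n + 1 ≥ `ades σ` the truncated difference of j and `ades σ` is the true one, so the
    -- polynomial takes an ordinary binomial coefficient as its value.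
    weight≡Ω : ∀ {j} σ → suc n ℕ.≤ j → weight (fromℕℚ j) σ ≡ fromℕℚ (Ω j σ)
    weight≡Ω {j} σ n<j = begin
      binomialℚ (fromℕℚ j + fromℕℚ n - fromℕℚ D) n    ≡⟨ cong (λ z → binomialℚ z n) argument ⟩
      binomialℚ (fromℕℚ m) n                          ≡⟨ binomialℚ≡C m n ⟩
      fromℕℚ (m C n)                                  ≡⟨ cong fromℕℚ count ⟨
      fromℕℚ (Ω j σ)                                  ∎
      where
      open ≡-Reasoning
      D = ades σ
      D≤j = ℕ.≤-trans (ades-≤ σ) n<j
      m = j ℕ.∸ D ℕ.+ n
      argument : fromℕℚ j + fromℕℚ n - fromℕℚ D ≡ fromℕℚ m
      argument = begin
        fromℕℚ j + fromℕℚ n - fromℕℚ D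
          ≡⟨ cong (λ z → fromℕℚ z + fromℕℚ n - fromℕℚ D) (ℕ.m∸n+n≡m D≤j) ⟨
        fromℕℚ (j ℕ.∸ D ℕ.+ D) + fromℕℚ n - fromℕℚ D
          ≡⟨ cong (λ z → z + fromℕℚ n - fromℕℚ D) (fromℕℚ-+ (j ℕ.∸ D) D) ⟩
        (fromℕℚ (j ℕ.∸ D) + fromℕℚ D) + fromℕℚ n - fromℕℚ D
          ≡⟨ solve 3 (λ e d n → (e :+ d) :+ n :- d := e :+ n) refl (fromℕℚ (j ℕ.∸ D)) (fromℕℚ D) (fromℕℚ n) ⟩
        fromℕℚ (j ℕ.∸ D) + fromℕℚ n
          ≡⟨ fromℕℚ-+ (j ℕ.∸ D) n ⟨
        fromℕℚ m ∎
      count : Ω j σ ≡ m C n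
      count = trans (length-chains (descent σ) (lastDescent σ) 0 j)
        (trans (cong (chainCount n j) (sym (ades≡ σ))) (chainCount-≤ n j D≤j))

  module _ {n : ℕ} where
    private
      module G = Group (𝔅 n)
    module _ .{{n≢0 : ℕ.NonZero n}} where
      ∈⇒valid : ∀ {j} {σ : SignedPerm n} {a} → a ∈ chainsFor j σ → Valid j σ (extend a)
      ∈⇒valid {j} {σ} {a} a∈ = chain⇒valid j σ a (chains-sound (descent σ) (lastDescent σ) 0 j a∈)

      valid⇒∈ : ∀ {j} {σ : SignedPerm n} {a} → Valid j σ (extend a) → a ∈ chainsFor j σ
      valid⇒∈ {j} {σ} {a} v = chains-complete (descent σ) (lastDescent σ) 0 j (valid⇒chain j σ a v)

      -- Signed permutations carry inverses and proofs and are compared only as functions, so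
      -- triples have to be counted up to this equivalence.
      Triple : Setoid _ _
      Triple = signedPermSetoid n ×ₛ (setoid (Vec ℕ n) ×ₛ setoid (Vec ℕ n))

      module _ (j k : ℕ) (π : SignedPerm n) where
        private
          module T = Setoid Triple
          open Membership Triple using () renaming (_∈_ to _∈ₜ_)

          fibre : SignedPerm n → List T.Carrier
          fibre σ = map (σ ,_) (cartesianProduct (chainsFor j σ) (chainsFor k (σ G.⁻¹ G.∙ π)))

        -- The second permutation is not recorded, being σ⁻¹π. The fibre over σ thus counts one
        -- summand of the coefficient of π in the product ψ(j)ψ(k).
        triples : List T.Carrier
        triples = concat (map fibre (signedPerms n))

        private
          fibre-sound : ∀ {σ′ σ : SignedPerm n} {a b} → (σ , a , b) ∈ₜ fibre σ′ →
                        σ G.≈ σ′ × (a , b) ∈ cartesianProduct (chainsFor j σ′) (chainsFor k (σ′ G.⁻¹ G.∙ π))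
          fibre-sound {σ′} {σ} t∈ = proj₁ (proj₂ (Any.satisfied t∈′)) , Any.map (λ { (_ , refl , refl) → refl }) t∈′
            where t∈′ = Any.map⁻ {f = σ′ ,_} t∈

          τ-cong : ∀ {σ σ′ : SignedPerm n} → σ G.≈ σ′ → σ G.⁻¹ G.∙ π G.≈ σ′ G.⁻¹ G.∙ π
          τ-cong {σ} {σ′} σ≈σ′ = G.∙-congʳ {π} {σ G.⁻¹} {σ′ G.⁻¹} (G.⁻¹-cong {σ} {σ′} σ≈σ′)

          triples-sound : ∀ {σ : SignedPerm n} {a b} → (σ , a , b) ∈ₜ triples →
                          Valid j σ (extend a) × Valid k (σ G.⁻¹ G.∙ π) (extend b)
          triples-sound {σ} {a} {b} t∈ with Any.satisfied (Any.map⁻ {f = fibre} (Any.concat⁻ (map fibre (signedPerms n)) t∈))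
          ... | σ′ , t∈′ with fibre-sound {σ′} {σ} {a} {b} t∈′
          ...   | σ≈σ′ , ab∈ with ∈-cartesianProduct⁻ (chainsFor j σ′) _ ab∈
          ...     | a∈ , b∈ =
            Valid-resp {σ = σ′} {σ} (G.sym {σ} {σ′} σ≈σ′) (λ _ → refl) (∈⇒valid a∈) ,
            Valid-resp {σ = σ′ G.⁻¹ G.∙ π} {σ G.⁻¹ G.∙ π} (τ-cong {σ′} {σ} (G.sym {σ} {σ′} σ≈σ′)) (λ _ → refl) (∈⇒valid b∈)

          triples-complete : ∀ {σ : SignedPerm n} {a b} → Valid j σ (extend a) → Valid k (σ G.⁻¹ G.∙ π) (extend b) →
                             (σ , a , b) ∈ₜ triples
          triples-complete {σ} {a} {b} va vb = Any.concat⁺ (Any.map⁺ (Any.map in-fibre (signedPerms-enumerates n σ)))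
            where
            in-fibre : ∀ {σ′ : SignedPerm n} → σ G.≈ σ′ → (σ , a , b) ∈ₜ fibre σ′
            in-fibre {σ′} σ≈σ′ = Any.map⁺ (Any.map (λ { refl → σ≈σ′ , refl , refl }) (∈-cartesianProduct⁺
              (valid⇒∈ (Valid-resp {σ = σ} {σ′} σ≈σ′ (λ _ → refl) va))
              (valid⇒∈ (Valid-resp {σ = σ G.⁻¹ G.∙ π} {σ′ G.⁻¹ G.∙ π} (τ-cong {σ} {σ′} σ≈σ′) (λ _ → refl) vb))))

          triples-unique : Unique Triple triples
          triples-unique = Unique.concat⁺ Triple
            (All.map⁺ (All.universal (λ σ → Unique.map⁺ (setoid _) Triple (λ { (_ , refl , refl) → refl })
              (Uniqueₚ.cartesianProduct⁺ (chains-unique _ _ 0 j) (chains-unique _ _ 0 k))) (signedPerms n)))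
            (AllPairs.map⁺ (AllPairs.map disjoint (signedPerms-unique n)))
            where
            disjoint : ∀ {σ σ′ : SignedPerm n} → ¬ σ G.≈ σ′ → ∀ {t} → ¬ (t ∈ₜ fibre σ × t ∈ₜ fibre σ′)
            disjoint {σ} {σ′} σ≉σ′ {ρ , a , b} (t∈ , t∈′) = σ≉σ′
              (G.trans {σ} {ρ} {σ′} (G.sym {ρ} {σ} (proj₁ (fibre-sound {σ} {ρ} {a} {b} t∈))) (proj₁ (fibre-sound {σ′} {ρ} {a} {b} t∈′)))

          compose : T.Carrier → Vec ℕ n
          compose (σ , a , b) = restrict (composite j (extend a) (σ G.⁻¹ G.∙ π) (extend b))

          σσ⁻¹π : ∀ (σ : SignedPerm n) → σ G.∙ (σ G.⁻¹ G.∙ π) G.≈ π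
          σσ⁻¹π σ s = G.inverseʳ σ (SignedPerm.perm π ⟨$⟩ʳ s)

          compose-valid : ∀ {σ : SignedPerm n} {a b} → Valid j σ (extend a) → Valid k (σ G.⁻¹ G.∙ π) (extend b) →
            Valid (2 ℕ.* j ℕ.* k) π (composite j (extend a) (σ G.⁻¹ G.∙ π) (extend b))
          compose-valid {σ} va vb = Valid-resp {σ = σ G.∙ (σ G.⁻¹ G.∙ π)} {π} (σσ⁻¹π σ) (λ _ → refl) (composite-valid va vb)

          compose-cong : ∀ {t t′ : T.Carrier} → t T.≈ t′ → compose t ≡ compose t′
          compose-cong {σ , a , b} {σ′ , _} (σ≈σ′ , refl , refl) = Vec.tabulate-cong λ i →
            cong (λ s → ℤ.∣ level j (extend b (pos (suc i))) (extend a s) ∣) (τ-cong {σ} {σ′} σ≈σ′ (pos (suc i)))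

          compose-∈ : ∀ {t : T.Carrier} → t ∈ₜ triples → compose t ∈ chainsFor (2 ℕ.* j ℕ.* k) π
          compose-∈ {σ , a , b} t∈ = valid⇒∈ {σ = π} (Valid-resp {σ = π} {π} (λ _ → refl) (λ s → sym (extend-restrict {σ = π} v s)) v)
            where
            vs = triples-sound {σ} {a} {b} t∈
            v = compose-valid {σ} {a} {b} (proj₁ vs) (proj₂ vs)

          extend-compose : ∀ {σ a b} → Valid j σ (extend a) → Valid k (σ G.⁻¹ G.∙ π) (extend b) →
            extend (compose (σ , a , b)) ≗ composite j (extend a) (σ G.⁻¹ G.∙ π) (extend b)
          extend-compose {σ} {a} {b} va vb = extend-restrict {σ = π} (compose-valid {σ} {a} {b} va vb)

          compose-injective : ∀ {t t′ : T.Carrier} → t ∈ₜ triples → t′ ∈ₜ triples → compose t ≡ compose t′ → t T.≈ t′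
          compose-injective {σ , a , b} {σ′ , a′ , b′} t∈ t′∈ eq =
            proj₁ same , extend-injective (proj₁ (proj₂ same)) , extend-injective (proj₂ (proj₂ same))
            where
            τ  = σ  G.⁻¹ G.∙ π
            τ′ = σ′ G.⁻¹ G.∙ π
            vs  = triples-sound {σ} {a} {b} t∈
            vs′ = triples-sound {σ′} {a′} {b′} t′∈
            same : σ G.≈ σ′ × extend a ≗ extend a′ × extend b ≗ extend b′
            same = composite-injective {n} {j} {k} {k} {σ} {σ′} {τ} {τ′}
              {extend a} {extend a′} {extend b} {extend b′} (proj₁ vs) (proj₁ vs′) (proj₂ vs) (proj₂ vs′)
              (λ s → trans (σσ⁻¹π σ s) (sym (σσ⁻¹π σ′ s)))
              (λ s → trans (sym (extend-compose {σ} {a} {b} (proj₁ vs) (proj₂ vs) s))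
                (trans (cong (λ c → extend c s) eq) (extend-compose {σ′} {a′} {b′} (proj₁ vs′) (proj₂ vs′) s)))

          compose-surjective : .{{_ : ℕ.NonZero j}} → ∀ {c} → c ∈ chainsFor (2 ℕ.* j ℕ.* k) π →
                               ∃ λ (t : T.Carrier) → t ∈ₜ triples × compose t ≡ c
          compose-surjective {c} c∈ = preimage (composite-surjective {n} {j} {k} {π} {extend c} (∈⇒valid {σ = π} c∈))
            where
            preimage : (∃ λ (σ : SignedPerm n) → ∃₂ λ A B → Valid j σ A × Valid k (σ G.⁻¹ G.∙ π) B ×
                         composite j A (σ G.⁻¹ G.∙ π) B ≗ extend c) →
                       ∃ λ (t : T.Carrier) → t ∈ₜ triples × compose t ≡ c
            preimage (σ , A , B , vA , vB , eq) = (σ , restrict A , restrict B) ,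
              triples-complete {σ} {restrict A} {restrict B} vA′ vB′ , extend-injective λ s →
                trans (extend-compose {σ} {restrict A} {restrict B} vA′ vB′ s)
                  (trans (cong₂ (level j) (extend-restrict {σ = τ} vB s) (extend-restrict {σ = σ} vA (τ · s))) (eq s))
              where
              τ = σ G.⁻¹ G.∙ π
              vA′ = Valid-resp {σ = σ} {σ} (λ _ → refl) (λ s → sym (extend-restrict {σ = σ} vA s)) vA
              vB′ = Valid-resp {σ = τ} {τ} (λ _ → refl) (λ s → sym (extend-restrict {σ = τ} vB s)) vB

        length-triples : .{{_ : ℕ.NonZero j}} → length triples ≡ Ω (2 ℕ.* j ℕ.* k) π
        length-triples = length-bijection Triple (setoid _) compose triples-unique
          (chains-unique (descent π) (lastDescent π) 0 (2 ℕ.* j ℕ.* k))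
          (λ {t} {t′} → compose-cong {t} {t′}) (λ {t} → compose-∈ {t})
          (λ {t} {t′} → compose-injective {t} {t′}) compose-surjective

        private
          length-fibre : ∀ σ → length (fibre σ) ≡ Ω j σ ℕ.* Ω k (σ G.⁻¹ G.∙ π)
          length-fibre σ = trans (List.length-map (σ ,_) (cartesianProduct (chainsFor j σ) (chainsFor k (σ G.⁻¹ G.∙ π))))
            (length-cartesianProduct (chainsFor j σ) (chainsFor k (σ G.⁻¹ G.∙ π)))

          length-concat-fibres : ∀ σs → fromℕℚ (length (concat (map fibre σs))) ≡
            ∑ σs (λ σ → fromℕℚ (Ω j σ) * fromℕℚ (Ω k (σ G.⁻¹ G.∙ π)))
          length-concat-fibres []       = refl
          length-concat-fibres (σ ∷ σs) = begin
            fromℕℚ (length (fibre σ ++ concat (map fibre σs)))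
              ≡⟨ cong fromℕℚ (List.length-++ (fibre σ)) ⟩
            fromℕℚ (length (fibre σ) ℕ.+ length (concat (map fibre σs)))
              ≡⟨ fromℕℚ-+ (length (fibre σ)) _ ⟩
            fromℕℚ (length (fibre σ)) + fromℕℚ (length (concat (map fibre σs)))
              ≡⟨ cong₂ _+_ (trans (cong fromℕℚ (length-fibre σ)) (fromℕℚ-* (Ω j σ) _)) (length-concat-fibres σs) ⟩
            fromℕℚ (Ω j σ) * fromℕℚ (Ω k (σ G.⁻¹ G.∙ π)) + _ ∎
            where open ≡-Reasoning

        ∑Ω*Ω : .{{_ : ℕ.NonZero j}} →
               ∑ (signedPerms n) (λ σ → fromℕℚ (Ω j σ) * fromℕℚ (Ω k (σ G.⁻¹ G.∙ π))) ≡ fromℕℚ (Ω (2 ℕ.* j ℕ.* k) π)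
        ∑Ω*Ω = trans (sym (length-concat-fibres (signedPerms n))) (cong fromℕℚ length-triples)

-- From values at even points to the polynomial identities.

module Products where
  open import Data.Rational.Base using (_+_; _*_; -_; _-_)
  open ℚ[x] using (fromℕℚ)
  open Evaluations
  open Counting
  open ≡-Reasoning

  private
    variable
      g ℓ : Level

  module _ (G : Group g ℓ) (_≟_ : Decidable (Group._≈_ G)) where
    private
      module G = Group G
      open Membership G.setoid using (_∈_)

    δ-cong : ∀ h {u v} → u G.≈ v → δ G _≟_ h u ≡ δ G _≟_ h v
    δ-cong h {u} {v} u≈v = cong (λ b → if b then 1ℚ else 0ℚ)
      (does-⇔ (mk⇔ (G.trans (G.sym u≈v)) (G.trans u≈v)) (u ≟ h) (v ≟ h))

    -- Moving u to the other side lets the inner sum over v select the single term u⁻¹h.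
    δ-translate : ∀ h u v → δ G _≟_ h (u G.∙ v) ≡ δ G _≟_ (u G.⁻¹ G.∙ h) v
    δ-translate h u v = cong (λ b → if b then 1ℚ else 0ℚ)
      (does-⇔ (mk⇔ to from) ((u G.∙ v) ≟ h) (v ≟ (u G.⁻¹ G.∙ h)))
      where
      open GroupProperties G using (\\-leftDividesʳ; \\-leftDividesˡ)
      to : u G.∙ v G.≈ h → v G.≈ u G.⁻¹ G.∙ h
      to uv≈h = G.trans (G.sym (\\-leftDividesʳ u v)) (G.∙-congˡ uv≈h)
      from : v G.≈ u G.⁻¹ G.∙ h → u G.∙ v G.≈ h
      from v≈ = G.trans (G.∙-congˡ v≈) (\\-leftDividesˡ u h)

    ∑-δ-∉ : ∀ (F : G.Carrier → ℚ) {h us} → All (λ u → ¬ h G.≈ u) us → ∑ us (λ u → F u * δ G _≟_ h u) ≡ 0ℚ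
    ∑-δ-∉ F []                        = refl
    ∑-δ-∉ F {h} {u ∷ us} (h≉u ∷ h∉us) with u ≟ h
    ... | yes u≈h = contradiction (G.sym u≈h) h≉u
    ... | no  _   = cong₂ _+_ (ℚ.*-zeroʳ (F u)) (∑-δ-∉ F h∉us)

    ∑-δ : ∀ (F : G.Carrier → ℚ) → (∀ {u v} → u G.≈ v → F u ≡ F v) → ∀ {h us} →
          Unique G.setoid us → h ∈ us → ∑ us (λ u → F u * δ G _≟_ h u) ≡ F h
    ∑-δ F F-cong {h} {u ∷ us} (u∉us ∷ us!) h∈ with u ≟ h
    ∑-δ F F-cong {h} {u ∷ us} (u∉us ∷ us!) h∈ | yes u≈h = begin
      F u * 1ℚ + ∑ us (λ v → F v * δ G _≟_ h v)
                        ≡⟨ cong₂ _+_ (ℚ.*-identityʳ (F u))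
                             (∑-δ-∉ F (All.map (λ u≉v h≈v → u≉v (G.trans u≈h h≈v)) u∉us)) ⟩
      F u + 0ℚ          ≡⟨ ℚ.+-identityʳ (F u) ⟩
      F u               ≡⟨ F-cong u≈h ⟩
      F h               ∎
    ∑-δ F F-cong {h} {u ∷ us} (u∉us ∷ us!) (here h≈u)  | no u≉h = contradiction (G.sym h≈u) u≉h
    ∑-δ F F-cong {h} {u ∷ us} (u∉us ∷ us!) (there h∈′) | no u≉h =
      trans (cong₂ _+_ (ℚ.*-zeroʳ (F u)) (∑-δ F F-cong us! h∈′)) (ℚ.+-identityˡ (F h))

  module _ (n : ℕ) .{{n≢0 : NonZero n}} where
    open Psi n using (module A; module A[x]; module A[x,y]; ψ; _⟪_⟫; scalar; x; y)
    open PsiEvaluation n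
    private
      module G = Group (𝔅 n)
      module AR = RawRing A[x,y].rawRing
      δₙ = δ (𝔅 n) _≟𝔅_

    weight-cong : ∀ p {σ τ : SignedPerm n} → σ G.≈ τ → weight p σ ≡ weight p τ
    weight-cong p {σ} {τ} σ≈τ = cong (λ d → binomialℚ (p + fromℕℚ n - fromℕℚ d) n) (ades-cong {σ = σ} {τ} σ≈τ)

    weight-sum : ∀ p h → ∑ (signedPerms n) (λ π → weight p π * δₙ h π) ≡ weight p h
    weight-sum p h = ∑-δ (𝔅 n) _≟𝔅_ (weight p) (λ {σ} {τ} → weight-cong p {σ} {τ}) {h} {signedPerms n}
      (signedPerms-unique n) (signedPerms-enumerates n h)

    -- The left side is the coefficient of h in ψ(j)ψ(k). Once the inner sum has collapsed, both
    -- weights are numbers of chains and `∑Ω*Ω` applies.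
    weight-product : ∀ {j k} h → suc n ℕ.≤ j → suc n ℕ.≤ k →
      ∑ (signedPerms n) (λ σ → weight (fromℕℚ j) σ *
        ∑ (signedPerms n) (λ τ → weight (fromℕℚ k) τ * δₙ h (σ G.∙ τ)))
      ≡ weight (fromℕℚ (2 ℕ.* j ℕ.* k)) h
    weight-product {j} {k} h n<j n<k = begin
      ∑ (signedPerms n) (λ σ → weight (fromℕℚ j) σ *
        ∑ (signedPerms n) (λ τ → weight (fromℕℚ k) τ * δₙ h (σ G.∙ τ)))
        ≡⟨ ∑-cong (signedPerms n) (λ σ → cong₂ _*_ (weight≡Ω σ n<j) (inner σ)) ⟩
      ∑ (signedPerms n) (λ σ → fromℕℚ (Ω j σ) * fromℕℚ (Ω k (σ G.⁻¹ G.∙ h)))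
        ≡⟨ ∑Ω*Ω j k h {{j≢0}} ⟩
      fromℕℚ (Ω (2 ℕ.* j ℕ.* k) h)
        ≡⟨ weight≡Ω h n<2jk ⟨
      weight (fromℕℚ (2 ℕ.* j ℕ.* k)) h ∎
      where
      j≢0 : NonZero j
      j≢0 = ℕ.>-nonZero (ℕ.≤-trans (ℕ.s≤s ℕ.z≤n) n<j)
      n<2jk : suc n ℕ.≤ 2 ℕ.* j ℕ.* k
      n<2jk = ℕ.≤-trans n<k (ℕ.m≤n*m k (2 ℕ.* j) {{ℕ.m*n≢0 2 j {{_}} {{j≢0}}}})
      inner : ∀ σ → ∑ (signedPerms n) (λ τ → weight (fromℕℚ k) τ * δₙ h (σ G.∙ τ))
                  ≡ fromℕℚ (Ω k (σ G.⁻¹ G.∙ h))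
      inner σ = begin
        ∑ (signedPerms n) (λ τ → weight (fromℕℚ k) τ * δₙ h (σ G.∙ τ))
          ≡⟨ ∑-cong (signedPerms n) (λ τ → cong (weight (fromℕℚ k) τ *_) (δ-translate (𝔅 n) _≟𝔅_ h σ τ)) ⟩
        ∑ (signedPerms n) (λ τ → weight (fromℕℚ k) τ * δₙ (σ G.⁻¹ G.∙ h) τ)
          ≡⟨ weight-sum (fromℕℚ k) (σ G.⁻¹ G.∙ h) ⟩
        weight (fromℕℚ k) (σ G.⁻¹ G.∙ h)
          ≡⟨ weight≡Ω (σ G.⁻¹ G.∙ h) n<k ⟩
        fromℕℚ (Ω k (σ G.⁻¹ G.∙ h)) ∎

    -- At these points x/2 and y/2 are natural numbers as well, so the same infinite set of points
    -- serves both identities.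
    even : ℕ → ℚ
    even i = fromℕℚ (2 ℕ.* i)

    even-injective : ∀ {i j} → even i ≡ even j → i ≡ j
    even-injective {i} {j} eq = ℕ.*-cancelˡ-≡ i j 2 (fromℕℚ-injective eq)

    private
      eval-ψ⟪⟫ : ∀ p q {s d} → I₂.IsScalar p q s d → ∀ φ → (∀ {u v} → u G.≈ v → φ u ≡ φ v) →
                 E₂.eval p q (ψ ⟪ s ⟫) φ ≡ ∑ (signedPerms n) (λ π → weight d π * φ π)
      eval-ψ⟪⟫ p q {s} {d} sd φ φ-cong =
        trans (eval-substitute p q sd ψ φ (λ {u} {v} → φ-cong {u} {v})) (eval-ψ d φ)

      eval-ψ⟪⟫*ψ⟪⟫ : ∀ p q {s t d e} → I₂.IsScalar p q s d → I₂.IsScalar p q t e →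
        ∀ φ → (∀ {u v} → u G.≈ v → φ u ≡ φ v) →
        E₂.eval p q (ψ ⟪ s ⟫ AR.* ψ ⟪ t ⟫) φ ≡
        ∑ (signedPerms n) (λ σ → weight d σ * ∑ (signedPerms n) (λ τ → weight e τ * φ (σ G.∙ τ)))
      eval-ψ⟪⟫*ψ⟪⟫ p q {s} {t} {d} {e} sd te φ φ-cong = begin
        E₂.eval p q (ψ ⟪ s ⟫ AR.* ψ ⟪ t ⟫) φ
          ≡⟨ I₂.*-homo p q (ψ ⟪ s ⟫) (ψ ⟪ t ⟫) φ ⟩
        E₂.eval p q (ψ ⟪ s ⟫) (λ σ → E₂.eval p q (ψ ⟪ t ⟫) (λ τ → φ (σ G.∙ τ)))
          ≡⟨ I₂.⟦⟧-cong p q (ψ ⟪ s ⟫) (λ σ → eval-ψ⟪⟫ p q te (λ τ → φ (σ G.∙ τ))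
               (λ {u} {v} u≈v → φ-cong {σ G.∙ u} {σ G.∙ v} (G.∙-congˡ {σ} {u} {v} u≈v))) ⟩
        E₂.eval p q (ψ ⟪ s ⟫) inner
          ≡⟨ eval-ψ⟪⟫ p q sd inner (λ {u} {v} u≈v → ∑-cong (signedPerms n) (λ τ →
               cong (weight e τ *_) (φ-cong {u G.∙ τ} {v G.∙ τ} (G.∙-congʳ {τ} {u} {v} u≈v)))) ⟩
        ∑ (signedPerms n) (λ σ → weight d σ * inner σ) ∎
        where
        inner : SignedPerm n → ℚ
        inner σ = ∑ (signedPerms n) (λ τ → weight e τ * φ (σ G.∙ τ))

    -- Here `c` turns the index of an even point into the value of the substituted polynomial: 2i
    -- for x itself and i for x/2. The condition i ≤ c i keeps these values above the threshold at
    -- which weights count chains.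
    ψ-product : ∀ s t r (c : ℕ → ℕ) → (∀ i → i ℕ.≤ c i) →
      (∀ i k → I₂.IsScalar (even i) (even k) s (fromℕℚ (c i))) →
      (∀ i k → I₂.IsScalar (even i) (even k) t (fromℕℚ (c k))) →
      (∀ i k → I₂.IsScalar (even i) (even k) r (fromℕℚ (2 ℕ.* c i ℕ.* c k))) →
      ψ ⟪ s ⟫ AR.* ψ ⟪ t ⟫ AR.≈ ψ ⟪ r ⟫
    ψ-product s t r c i≤ci s-scalar t-scalar r-scalar k l h = begin
      A.coeffAt h (A[x].coeff (A[x,y].coeff lhs k) l)
        ≡⟨ coeffAt≡⟦⟧δ (𝔅 n) _≟𝔅_ h (A[x].coeff (A[x,y].coeff lhs k) l) ⟩
      I₀.⟦ A[x].coeff (A[x,y].coeff lhs k) l ⟧ (δₙ h)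
        -- The inner application removes y, over coefficients already evaluated at x = `even i`; the
        -- outer one then removes x.
        ≡⟨ polynomial-identity even-injective I₀ (A[x,y].coeff lhs k) (A[x,y].coeff rhs k) (δₙ h) (suc n)
             (λ i n<i → polynomial-identity even-injective (E₁.interpretation (even i)) lhs rhs (δₙ h) (suc n)
               (λ j n<j → at-points i j n<i n<j) k) l ⟩
      I₀.⟦ A[x].coeff (A[x,y].coeff rhs k) l ⟧ (δₙ h)
        ≡⟨ coeffAt≡⟦⟧δ (𝔅 n) _≟𝔅_ h (A[x].coeff (A[x,y].coeff rhs k) l) ⟨
      A.coeffAt h (A[x].coeff (A[x,y].coeff rhs k) l) ∎
      where
      lhs = ψ ⟪ s ⟫ AR.* ψ ⟪ t ⟫
      rhs = ψ ⟪ r ⟫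

      φ-cong : ∀ {u v} → u G.≈ v → δₙ h u ≡ δₙ h v
      φ-cong {u} {v} = δ-cong (𝔅 n) _≟𝔅_ h {u} {v}

      at-points : ∀ i j → suc n ℕ.≤ i → suc n ℕ.≤ j →
                  E₂.eval (even i) (even j) lhs (δₙ h) ≡ E₂.eval (even i) (even j) rhs (δₙ h)
      at-points i j n<i n<j =
        trans (eval-ψ⟪⟫*ψ⟪⟫ (even i) (even j) (s-scalar i j) (t-scalar i j) (δₙ h) (λ {u} {v} → φ-cong {u} {v}))
        (trans (weight-product h (ℕ.≤-trans n<i (i≤ci i)) (ℕ.≤-trans n<j (i≤ci j)))
        (sym (trans (eval-ψ⟪⟫ (even i) (even j) (r-scalar i j) (δₙ h) (λ {u} {v} → φ-cong {u} {v}))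
                    (weight-sum (fromℕℚ (2 ℕ.* c i ℕ.* c j)) h))))

    ½-even : ∀ i → ½ * even i ≡ fromℕℚ i
    ½-even i = begin
      ½ * even i                 ≡⟨ cong (½ *_) (fromℕℚ-* 2 i) ⟩
      ½ * (fromℕℚ 2 * fromℕℚ i)  ≡⟨ ℚ.*-assoc ½ (fromℕℚ 2) (fromℕℚ i) ⟨
      1ℚ * fromℕℚ i              ≡⟨ ℚ.*-identityˡ (fromℕℚ i) ⟩
      fromℕℚ i                   ∎

    2-even-even : ∀ i k → ℤ.+ 2 / 1 * even i * even k ≡ fromℕℚ (2 ℕ.* (2 ℕ.* i) ℕ.* (2 ℕ.* k))
    2-even-even i k = begin
      fromℕℚ 2 * even i * even k                ≡⟨ cong (_* even k) (fromℕℚ-* 2 (2 ℕ.* i)) ⟨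
      fromℕℚ (2 ℕ.* (2 ℕ.* i)) * even k         ≡⟨ fromℕℚ-* (2 ℕ.* (2 ℕ.* i)) (2 ℕ.* k) ⟨
      fromℕℚ (2 ℕ.* (2 ℕ.* i) ℕ.* (2 ℕ.* k))    ∎

    ½-even-even : ∀ i k → ½ * even i * even k ≡ fromℕℚ (2 ℕ.* i ℕ.* k)
    ½-even-even i k = begin
      ½ * even i * even k      ≡⟨ cong (_* even k) (½-even i) ⟩
      fromℕℚ i * even k        ≡⟨ fromℕℚ-* i (2 ℕ.* k) ⟨
      fromℕℚ (i ℕ.* (2 ℕ.* k)) ≡⟨ cong fromℕℚ (ℕ.*-assoc i 2 k) ⟨
      fromℕℚ (i ℕ.* 2 ℕ.* k)   ≡⟨ cong (λ z → fromℕℚ (z ℕ.* k)) (ℕ.*-comm i 2) ⟩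
      fromℕℚ (2 ℕ.* i ℕ.* k)   ∎

    private
      scaled-x : ∀ p q s → I₂.IsScalar p q (scalar s AR.* x) (s * p)
      scaled-x p q s = I₂.scalar-* p q (scalar-scalar p q s) (scalar-x p q)

      scaled-y : ∀ p q s → I₂.IsScalar p q (scalar s AR.* y) (s * q)
      scaled-y p q s = I₂.scalar-* p q (scalar-scalar p q s) (scalar-y p q)

      scaled-xy : ∀ p q s → I₂.IsScalar p q (scalar s AR.* x AR.* y) (s * p * q)
      scaled-xy p q s = I₂.scalar-* p q (scaled-x p q s) (scalar-y p q)

    ψx*ψy : ∀ s → (∀ i k → s * even i * even k ≡ fromℕℚ (2 ℕ.* (2 ℕ.* i) ℕ.* (2 ℕ.* k))) →
            ψ ⟪ x ⟫ AR.* ψ ⟪ y ⟫ AR.≈ ψ ⟪ scalar s AR.* x AR.* y ⟫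
    ψx*ψy s s-even-even = ψ-product x y (scalar s AR.* x AR.* y) (2 ℕ.*_) (λ i → ℕ.m≤n*m i 2)
      (λ i k → scalar-x (even i) (even k))
      (λ i k → scalar-y (even i) (even k))
      (λ i k → subst (I₂.IsScalar (even i) (even k) _) (s-even-even i k) (scaled-xy (even i) (even k) s))

    ψsx*ψsy : ∀ s → (∀ i → s * even i ≡ fromℕℚ i) → (∀ i k → s * even i * even k ≡ fromℕℚ (2 ℕ.* i ℕ.* k)) →
              ψ ⟪ scalar s AR.* x ⟫ AR.* ψ ⟪ scalar s AR.* y ⟫ AR.≈ ψ ⟪ scalar s AR.* x AR.* y ⟫
    ψsx*ψsy s s-even s-even-even =
      ψ-product (scalar s AR.* x) (scalar s AR.* y) (scalar s AR.* x AR.* y) id (λ _ → ℕ.≤-refl)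
      (λ i k → subst (I₂.IsScalar (even i) (even k) _) (s-even i) (scaled-x (even i) (even k) s))
      (λ i k → subst (I₂.IsScalar (even i) (even k) _) (s-even k) (scaled-y (even i) (even k) s))
      (λ i k → subst (I₂.IsScalar (even i) (even k) _) (s-even-even i k) (scaled-xy (even i) (even k) s))

open import Data.Integer.Base using (+_)
open Products using (ψx*ψy; ψsx*ψsy; 2-even-even; ½-even; ½-even-even)

theorem1p4 : (n : ℕ) → .{{_ : NonZero n}} → let open Psi n in
    (ψ ⟪ x ⟫ * ψ ⟪ y ⟫ ≈ ψ ⟪ scalar (+ 2 / 1) * x * y ⟫)
    × (ψ ⟪ scalar ½ * x ⟫ * ψ ⟪ scalar ½ * y ⟫ ≈ ψ ⟪ scalar ½ * x * y ⟫)
theorem1p4 n = ψx*ψy n (+ 2 / 1) (2-even-even n) , ψsx*ψsy n ½ (½-even n) (½-even-even n)
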